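{- Let $q$ be a prime power, $n\ge1$, $\sigma$ a generator of $\mathrm{Gal}(\mathbb{F}_{q^n}/\mathbb{F}_q)$, and $L=a_0x+\dots+a_dx^{\sigma^d}\in\mathbb{F}_{q^n}[x]$ a $\sigma$-linearized polynomial of $\sigma$-degree $d\ge1$. Then all coefficients of the characteristic polynomial of $A_L$ lie in $\mathbb{F}_q$.
   Context: $C_L$ is the $d\times d$ matrix with $1$'s on the subdiagonal, last column $(-a_0/a_d,\dots,-a_{d-1}/a_d)^T$, zeros elsewhere; $C_L^{\sigma^i}$ denotes entrywise application of $\sigma^i$; $A_L:=C_LC_L^{\sigma}\cdots C_L^{\sigma^{n-1}}$. -}

module Defs where

open import Level using (Level; _⊔_)
open import Data.Nat using (ℕ; zero; suc; _≟_)
open import Data.Fin using (Fin; zero; suc; toℕ; punchIn)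
import Data.Fin as Fin
open import Data.List using (List; []; _∷_; map)
open import Relation.Nullary using (does)
open import Data.Bool using (Bool; true; false; not; if_then_else_)
open import Algebra.Bundles using (CommutativeRing)

module _ {c ℓ : Level} (R : CommutativeRing c ℓ) where
  open CommutativeRing R hiding (zero)

  isEven : ℕ → Bool
  isEven zero    = true
  isEven (suc k) = not (isEven k)

  pow : Carrier → ℕ → Carrier
  pow x zero    = 1#
  pow x (suc k) = x * pow x k

  iter : (Carrier → Carrier) → ℕ → Carrier → Carrier
  iter f zero    x = x
  iter f (suc k) x = f (iter f k x)

  -- Polynomials over the ring: coefficient lists, constant term first.
  Poly : Set c
  Poly = List Carrier

  coeff : Poly → ℕ → Carrier
  coeff []      _       = 0#
  coeff (a ∷ p) zero    = a
  coeff (a ∷ p) (suc i) = coeff p i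

  padd : Poly → Poly → Poly
  padd []      q       = q
  padd (a ∷ p) []      = a ∷ p
  padd (a ∷ p) (b ∷ q) = (a + b) ∷ padd p q

  pneg : Poly → Poly
  pneg = map (-_)

  pmul : Poly → Poly → Poly
  pmul []      q = []
  pmul (a ∷ p) q = padd (map (a *_) q) (0# ∷ pmul p q)

  pconst : Carrier → Poly
  pconst a = a ∷ []

  pX : Poly
  pX = 0# ∷ 1# ∷ []

  psum : ∀ {m} → (Fin m → Poly) → Poly
  psum {zero}  f = []
  psum {suc m} f = padd (f zero) (psum (λ j → f (suc j)))

  pdet : ∀ m → (Fin m → Fin m → Poly) → Poly
  pdet zero    M = pconst 1#
  pdet (suc m) M = psum (λ j → sgn j (pmul (M zero j)
                          (pdet m (λ r s → M (suc r) (punchIn j s)))))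
    where
    sgn : Fin (suc m) → Poly → Poly
    sgn j p = if isEven (toℕ j) then p else pneg p

  Mat : ℕ → Set c
  Mat m = Fin m → Fin m → Carrier

  idMat : ∀ {m} → Mat m
  idMat i j = if does (i Fin.≟ j) then 1# else 0#

  sumF : ∀ {m} → (Fin m → Carrier) → Carrier
  sumF {zero}  f = 0#
  sumF {suc m} f = f zero + sumF (λ j → f (suc j))

  mmul : ∀ {m} → Mat m → Mat m → Mat m
  mmul A B i j = sumF (λ k → A i k * B k j)

  mapMat : ∀ {m} → (Carrier → Carrier) → Mat m → Mat m
  mapMat f A i j = f (A i j)

  charPoly : ∀ m → Mat m → Poly
  charPoly m A = pdet m (λ i j →
    if does (i Fin.≟ j) then padd pX (pneg (pconst (A i j)))
                        else pneg (pconst (A i j)))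

  -- Companion matrix C_L (d × d) of L = a₀x + … + a_d x^{σ^d}, given
  -- ainv, the inverse of the leading coefficient a_d:
  -- 1's on the subdiagonal, last column (-a₀/a_d, …, -a_{d-1}/a_d)ᵀ.
  companion : ∀ d → (Fin (suc d) → Carrier) → Carrier → Mat d
  companion d a ainv i j =
    if does (suc (toℕ j) ≟ d) then - (a (Fin.inject₁ i) * ainv)
    else (if does (toℕ i ≟ suc (toℕ j)) then 1# else 0#)

  twistedProd : ∀ {m} → (Carrier → Carrier) → Mat m → ℕ → ℕ → Mat m
  twistedProd σ C zero    k = idMat
  twistedProd σ C (suc r) k = mmul (mapMat (iter σ k) C) (twistedProd σ C r (suc k))

  AL : ∀ d → (Carrier → Carrier) → ℕ → (Fin (suc d) → Carrier) → Carrier → Mat d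
  AL d σ n a ainv = twistedProd σ (companion d a ainv) n 0

{-# OPTIONS --safe #-}
module Submission where

-- Write C for the companion matrix and A for A_L. Since σⁿ = 1, C · σ(A) = C C^σ ⋯ C^{σⁿ} = A · C
-- up to regrouping. If a₀ ≠ 0, then C is invertible, so σ(A) and A have the same characteristic
-- polynomial; if a₀ = 0, the first row of A vanishes and the characteristic polynomial is X times
-- that of the smaller L. Hence σ fixes all its coefficients, and so does the Frobenius map
-- φ : x ↦ x^q, which is a power of σ because σ generates the Galois group.
-- That σⁿ = 1 follows from φⁿ = 1: the coefficients of ∏_{j<n} (X − φʲ x) are fixed by φ, hence by
-- σ, so σ x = φʲ x for some j depending on x. As σ commutes with φ, σⁿ x = φ^{nj} x = x.

-- The matrix X·1 - A has polynomial entries, so the multiplicativity of determinants behind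
-- similarity is needed over a ring that is not a field. It is proved for every commutative ring,
-- from the uniqueness of alternating forms instead of a sum over permutations. Invertibility of C
-- then enters only through its determinant, ± a₀/a_d, being a unit in the polynomial ring. The
-- Galois group is not given as an object: σ is known by the elements it must fix and by the
-- automorphisms that must be its powers. The order of σ is therefore not at hand, which is why σⁿ =
-- 1 takes an argument about conjugates. Three facts come from the enumeration of the field by q^n
-- indices: equality is decidable, which permits the distinction on a₀; the characteristic is p,
-- which makes φ additive; and x^(q^n) = x, which gives φⁿ = 1. Membership in the subfield of q
-- elements is expressed as x^q = x, so being fixed by φ is literally the conclusion.

open import Defs
open import Data.Nat using (ℕ; zero; suc; _≤_; _<_; _^_; s≤s; z≤n)
open import Data.Nat.Primality using (Prime; euclidsLemma; ¬prime[0])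
open import Data.Fin using (Fin; zero; suc; toℕ; fromℕ; inject₁; punchIn)
open import Data.Product using (∃; _×_; _,_; proj₁; proj₂)
open import Relation.Nullary using (¬_; Dec; yes; no; does; contradiction)
open import Relation.Nullary.Decidable using (dec-true; dec-false)
open import Relation.Binary.PropositionalEquality using (_≡_; _≢_)
import Relation.Binary.PropositionalEquality as Eq
open import Relation.Binary.Consequences using (dec⇒weaklyDec)
open import Function using (_∘_)
open import Function.Bundles using (Bijection)
open import Level using (_⊔_)
open import Algebra.Bundles using (CommutativeRing)
open import Algebra.Morphism.Structures using (module RingMorphisms)
import Algebra.Properties.CommutativeMonoid.Sum as CommutativeMonoidSum
import Algebra.Solver.Ring
open import Algebra.Solver.Ring.AlmostCommutativeRing using (fromCommutativeRing; _-Raw-AlmostCommutative⟶_)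
open import Data.Bool.Base using (true; false; not; if_then_else_)
import Data.Bool.Properties as Bool
import Data.Fin.Properties as Fin
open import Data.Fin.Permutation using (Permutation; permutation; _⟨$⟩ʳ_)
open import Data.Integer.Base using (0ℤ; 1ℤ)
import Data.Maybe as Maybe
import Data.Nat.Base as ℕ
import Data.Nat.Properties as ℕ
open import Data.Sum using (_⊎_; inj₁; inj₂; [_,_]′)
open import Data.Unit.Polymorphic using (⊤)

-- Ring identities by normalisation with integer coefficients

module IntegerSolver {c ℓ} (S : CommutativeRing c ℓ) where
  open CommutativeRing S hiding (zero)
  open import Data.Integer.Base as ℤ using (ℤ; +_; -[1+_]; _⊖_)
  import Data.Integer.Properties as ℤ
  open import Algebra.Properties.Ring ring
  open import Algebra.Properties.Semiring.Mult semiring using () renaming (_×_ to _·_; ×-homo-+ to ·-homo-+)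
  open import Relation.Binary.Reasoning.Setoid setoid

  -- Normalisation has to compare coefficients, and equality in an arbitrary ring need not be
  -- decidable. The integers have decidable equality and map to every ring.
  fromℤ : ℤ → Carrier
  fromℤ (+ n)    = n · 1#
  fromℤ -[1+ n ] = - (suc n · 1#)

  fromℤ-⊖ : ∀ m n → fromℤ (m ⊖ n) ≈ m · 1# - n · 1#
  fromℤ-⊖ m       zero    = sym (trans (+-congˡ -0#≈0#) (+-identityʳ _))
  fromℤ-⊖ zero    (suc n) = sym (+-identityˡ _)
  fromℤ-⊖ (suc m) (suc n) = begin
    fromℤ (suc m ⊖ suc n)               ≡⟨ Eq.cong fromℤ (ℤ.[1+m]⊖[1+n]≡m⊖n m n) ⟩
    fromℤ (m ⊖ n)                       ≈⟨ fromℤ-⊖ m n ⟩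
    m · 1# - n · 1#                     ≈⟨ +-congʳ (xyx⁻¹≈y 1# _) ⟨
    1# + m · 1# - 1# - n · 1#           ≈⟨ +-assoc _ _ _ ⟩
    1# + m · 1# + (- 1# - n · 1#)       ≈⟨ +-congˡ (-‿+-comm 1# _) ⟩
    suc m · 1# - suc n · 1#             ∎

  fromℤ-neg : ∀ i → fromℤ (ℤ.- i) ≈ - fromℤ i
  fromℤ-neg (+ zero)  = sym -0#≈0#
  fromℤ-neg (+ suc n) = refl
  fromℤ-neg -[1+ n ]  = sym (-‿involutive _)

  fromℤ-+ : ∀ i j → fromℤ (i ℤ.+ j) ≈ fromℤ i + fromℤ j
  fromℤ-+ (+ m)    (+ n)    = ·-homo-+ 1# m n
  fromℤ-+ (+ m)    -[1+ n ] = fromℤ-⊖ m (suc n)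
  fromℤ-+ -[1+ m ] (+ n)    = trans (fromℤ-⊖ n (suc m)) (+-comm _ _)
  fromℤ-+ -[1+ m ] -[1+ n ] = trans (-‿cong (begin
    suc (suc (m ℕ.+ n)) · 1#    ≈⟨ +-congˡ (·-homo-+ 1# (suc m) n) ⟩
    1# + (suc m · 1# + n · 1#)  ≈⟨ +-assoc _ _ _ ⟨
    1# + suc m · 1# + n · 1#    ≈⟨ +-congʳ (+-comm _ _) ⟩
    suc m · 1# + 1# + n · 1#    ≈⟨ +-assoc _ _ _ ⟩
    suc m · 1# + suc n · 1#     ∎)) (sym (-‿+-comm _ _))

  fromℤ-*⁺ : ∀ m j → fromℤ (+ m ℤ.* j) ≈ m · 1# * fromℤ j
  fromℤ-*⁺ zero    j = sym (zeroˡ _)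
  fromℤ-*⁺ (suc m) j = begin
    fromℤ (+ suc m ℤ.* j)               ≡⟨ Eq.cong fromℤ (ℤ.suc-* (+ m) j) ⟩
    fromℤ (j ℤ.+ + m ℤ.* j)             ≈⟨ fromℤ-+ j (+ m ℤ.* j) ⟩
    fromℤ j + fromℤ (+ m ℤ.* j)         ≈⟨ +-cong (sym (*-identityˡ _)) (fromℤ-*⁺ m j) ⟩
    1# * fromℤ j + m · 1# * fromℤ j     ≈⟨ distribʳ _ _ _ ⟨
    suc m · 1# * fromℤ j                ∎

  fromℤ-* : ∀ i j → fromℤ (i ℤ.* j) ≈ fromℤ i * fromℤ j
  fromℤ-* (+ m)    j = fromℤ-*⁺ m j
  fromℤ-* -[1+ m ] j = begin
    fromℤ (-[1+ m ] ℤ.* j)        ≡⟨ Eq.cong fromℤ (ℤ.neg-distribˡ-* (+ suc m) j) ⟨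
    fromℤ (ℤ.- (+ suc m ℤ.* j))   ≈⟨ fromℤ-neg (+ suc m ℤ.* j) ⟩
    - fromℤ (+ suc m ℤ.* j)       ≈⟨ -‿cong (fromℤ-*⁺ (suc m) j) ⟩
    - (suc m · 1# * fromℤ j)      ≈⟨ -‿distribˡ-* _ _ ⟩
    fromℤ -[1+ m ] * fromℤ j      ∎

  morphism : ℤ.+-*-rawRing -Raw-AlmostCommutative⟶ fromCommutativeRing S
  morphism = record
    { ⟦_⟧    = fromℤ
    ; +-homo = fromℤ-+
    ; *-homo = fromℤ-*
    ; -‿homo = fromℤ-neg
    ; 0-homo = refl
    ; 1-homo = +-identityʳ 1#
    }

  open Algebra.Solver.Ring ℤ.+-*-rawRing (fromCommutativeRing S) morphism
    (λ i j → Maybe.map (λ i≡j → reflexive (Eq.cong fromℤ i≡j)) (dec⇒weaklyDec ℤ._≟_ i j)) public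

-- Finite sums and matrices over a commutative ring

punchIn-elim : ∀ {p n} (P : Fin (suc n) → Set p) i → P i → (∀ j → P (punchIn i j)) → ∀ k → P k
punchIn-elim             P zero    Pi Pj zero    = Pi
punchIn-elim             P zero    Pi Pj (suc k) = Pj k
punchIn-elim {n = suc n} P (suc i) Pi Pj zero    = Pj zero
punchIn-elim {n = suc n} P (suc i) Pi Pj (suc k) = punchIn-elim (P ∘ suc) i Pi (Pj ∘ suc) k

module Determinant {c ℓ} (S : CommutativeRing c ℓ) where
  open CommutativeRing S hiding (zero)
  open import Data.Vec.Functional using (Vector; _∷_; insertAt)
  open import Algebra.Properties.Ring ring
  open import Relation.Binary.Reasoning.Setoid setoid
  open IntegerSolver S using (solve; _:=_; _:+_; _:*_; :-_; con)
  open import Algebra.Properties.Semiring.Sum semiring using (sum; ∑-distrib-+; *-distribˡ-sum; *-distribʳ-sum)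

  private
    variable
      m n r : ℕ

  infix 4 _≋_
  _≋_ : Vector Carrier n → Vector Carrier n → Set ℓ
  u ≋ v = ∀ i → u i ≈ v i

  δ : Fin n → Fin n → Carrier
  δ = idMat S

  sign : Fin n → Carrier
  sign zero    = 1#
  sign (suc i) = - sign i

  -- Opaque, so that unification can read the summand off a sum.
  opaque
    ∑ : Vector Carrier n → Carrier
    ∑ = sumF S

    ± : Vector Carrier n → Carrier
    ± {zero}  f = 0#
    ± {suc n} f = f zero - ± (f ∘ suc)

    ∑-unfold : (f : Vector Carrier n) → sumF S f ≡ ∑ f
    ∑-unfold f = Eq.refl

    ∑≡sum : (f : Vector Carrier n) → ∑ f ≡ sum f
    ∑≡sum {zero}  f = Eq.refl
    ∑≡sum {suc n} f = Eq.cong (f zero +_) (∑≡sum (f ∘ suc))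

    ∑-0 : {f : Vector Carrier n} → (∀ i → f i ≈ 0#) → ∑ f ≈ 0#
    ∑-0 {zero}  f≈0 = refl
    ∑-0 {suc n} f≈0 = trans (+-cong (f≈0 zero) (∑-0 (f≈0 ∘ suc))) (+-identityˡ 0#)

    ∑-cong : {f g : Vector Carrier n} → f ≋ g → ∑ f ≈ ∑ g
    ∑-cong {zero}  f≋g = refl
    ∑-cong {suc n} f≋g = +-cong (f≋g zero) (∑-cong (f≋g ∘ suc))

    ∑-nil : (f : Vector Carrier 0) → ∑ f ≡ 0#
    ∑-nil f = Eq.refl

    ∑-suc : (f : Vector Carrier (suc n)) → ∑ f ≡ f zero + ∑ (f ∘ suc)
    ∑-suc f = Eq.refl

    ±-suc : (f : Vector Carrier (suc n)) → ± f ≡ f zero - ± (f ∘ suc)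
    ±-suc f = Eq.refl

    ±-0 : {f : Vector Carrier n} → (∀ i → f i ≈ 0#) → ± f ≈ 0#
    ±-0 {zero}  f≈0 = refl
    ±-0 {suc n} f≈0 = trans (+-cong (f≈0 zero) (trans (-‿cong (±-0 {n} (f≈0 ∘ suc))) -0#≈0#)) (+-identityˡ 0#)

    ±-cong : {f g : Vector Carrier n} → f ≋ g → ± f ≈ ± g
    ±-cong {zero}  f≋g = refl
    ±-cong {suc n} f≋g = +-cong (f≋g zero) (-‿cong (±-cong (f≋g ∘ suc)))

    ±-linear : ∀ x (f g : Vector Carrier n) → ± (λ i → x * f i + g i) ≈ x * ± f + ± g
    ±-linear {zero}  x f g = sym (trans (+-identityʳ _) (zeroʳ x))
    ±-linear {suc n} x f g = trans (+-congˡ (-‿cong (±-linear x (f ∘ suc) (g ∘ suc))))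
      (solve 5 (λ x a b c d → x :* a :+ b :+ :- (x :* c :+ d) := x :* (a :+ :- c) :+ (b :+ :- d)) refl
        x (f zero) (g zero) (± (f ∘ suc)) (± (g ∘ suc)))

    -- The factor `y` is arbitrary so that the induction can pass to `- y`, which absorbs the sign
    -- change between an alternating sum and its tail.
    ∑-sign : ∀ (f : Vector Carrier n) y → ∑ (λ i → f i * (sign i * y)) ≈ ± f * y
    ∑-sign {zero}  f y = sym (zeroˡ y)
    ∑-sign {suc n} f y = trans
      (+-cong (*-congˡ (*-identityˡ y)) (trans
        (∑-cong {n} (λ i → *-congˡ (solve 2 (λ s y → :- s :* y := s :* :- y) refl (sign i) y)))
        (∑-sign (f ∘ suc) (- y))))
      (solve 3 (λ a b y → a :* y :+ b :* :- y := (a :+ :- b) :* y) refl (f zero) (± (f ∘ suc)) y)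

  ∑-+ : (f g : Vector Carrier n) → ∑ (λ i → f i + g i) ≈ ∑ f + ∑ g
  ∑-+ f g rewrite ∑≡sum (λ i → f i + g i) | ∑≡sum f | ∑≡sum g = ∑-distrib-+ f g

  ∑-*ˡ : ∀ x (f : Vector Carrier n) → ∑ (λ i → x * f i) ≈ x * ∑ f
  ∑-*ˡ x f rewrite ∑≡sum (λ i → x * f i) | ∑≡sum f = sym (*-distribˡ-sum x f)

  ∑-*ʳ : ∀ x (f : Vector Carrier n) → ∑ (λ i → f i * x) ≈ ∑ f * x
  ∑-*ʳ x f rewrite ∑≡sum (λ i → f i * x) | ∑≡sum f = sym (*-distribʳ-sum x f)

  ∑-linear : ∀ x (f g : Vector Carrier n) → ∑ (λ i → x * f i + g i) ≈ x * ∑ f + ∑ g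
  ∑-linear x f g = trans (∑-+ _ g) (+-congʳ (∑-*ˡ x f))

  ∑-swap : (f : Fin m → Fin n → Carrier) → ∑ (λ i → ∑ (f i)) ≈ ∑ (λ j → ∑ (λ i → f i j))
  ∑-swap {zero}  f = trans (reflexive (∑-nil _)) (sym (∑-0 (λ j → reflexive (∑-nil _))))
  ∑-swap {suc m} f = begin
    ∑ (λ i → ∑ (f i))                             ≡⟨ ∑-suc _ ⟩
    ∑ (f zero) + ∑ (λ i → ∑ (f (suc i)))          ≈⟨ +-congˡ (∑-swap (f ∘ suc)) ⟩
    ∑ (f zero) + ∑ (λ j → ∑ (λ i → f (suc i) j))  ≈⟨ ∑-+ (f zero) _ ⟨
    ∑ (λ j → f zero j + ∑ (λ i → f (suc i) j))    ≈⟨ ∑-cong (λ j → reflexive (∑-suc (λ i → f i j))) ⟨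
    ∑ (λ j → ∑ (λ i → f i j))                     ∎

  ∑-δˡ : ∀ (i : Fin n) (f : Vector Carrier n) → ∑ (λ j → δ i j * f j) ≈ f i
  ∑-δˡ zero    f = trans (reflexive (∑-suc _)) (trans (+-cong (*-identityˡ _) (∑-0 (λ j → zeroˡ _))) (+-identityʳ _))
  ∑-δˡ (suc i) f = trans (reflexive (∑-suc _)) (trans (+-cong (zeroˡ _) (∑-δˡ i (f ∘ suc))) (+-identityˡ _))

  ∑-δʳ : ∀ (j : Fin n) (f : Vector Carrier n) → ∑ (λ i → f i * δ i j) ≈ f j
  ∑-δʳ zero    f = trans (reflexive (∑-suc _)) (trans (+-cong (*-identityʳ _) (∑-0 (λ j → zeroʳ _))) (+-identityʳ _))
  ∑-δʳ (suc j) f = trans (reflexive (∑-suc _)) (trans (+-cong (zeroʳ _) (∑-δʳ j (f ∘ suc))) (+-identityˡ _))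

  infixl 7 _⊠_
  _⊠_ : Mat S n → Mat S n → Mat S n
  (A ⊠ B) i j = ∑ (λ k → A i k * B k j)

  ⊠-cong : {A B C D : Mat S n} → (∀ i j → A i j ≈ B i j) → (∀ i j → C i j ≈ D i j) →
    ∀ i j → (A ⊠ C) i j ≈ (B ⊠ D) i j
  ⊠-cong A≈B C≈D i j = ∑-cong (λ k → *-cong (A≈B i k) (C≈D k j))

  ⊠-assoc : ∀ (A B C : Mat S n) i j → (A ⊠ B ⊠ C) i j ≈ (A ⊠ (B ⊠ C)) i j
  ⊠-assoc A B C i j = begin
    ∑ (λ k → ∑ (λ l → A i l * B l k) * C k j)    ≈⟨ ∑-cong (λ k → ∑-*ʳ (C k j) (λ l → A i l * B l k)) ⟨
    ∑ (λ k → ∑ (λ l → A i l * B l k * C k j))    ≈⟨ ∑-swap _ ⟩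
    ∑ (λ l → ∑ (λ k → A i l * B l k * C k j))    ≈⟨ ∑-cong (λ l → ∑-cong (λ k → *-assoc _ _ _)) ⟩
    ∑ (λ l → ∑ (λ k → A i l * (B l k * C k j)))  ≈⟨ ∑-cong (λ l → ∑-*ˡ (A i l) _) ⟩
    ∑ (λ l → A i l * ∑ (λ k → B l k * C k j))    ∎

  -- Alternating forms in the rows of a matrix, and the determinant

  Matrix : ℕ → ℕ → Set c
  Matrix r n = Fin r → Vector Carrier n

  infix 4 _≋ₘ_
  _≋ₘ_ : Matrix r n → Matrix r n → Set ℓ
  A ≋ₘ B = ∀ i → A i ≋ B i

  ∷-cong : {u v : Vector Carrier n} {A B : Matrix r n} → u ≋ v → A ≋ₘ B → (u ∷ A) ≋ₘ (v ∷ B)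
  ∷-cong u≋v A≋B zero    = u≋v
  ∷-cong u≋v A≋B (suc i) = A≋B i

  ∷-map : ∀ {k} (L : Vector Carrier n → Vector Carrier k) u (A : Matrix r n) → (L u ∷ (L ∘ A)) ≋ₘ (L ∘ (u ∷ A))
  ∷-map L u A zero    i = refl
  ∷-map L u A (suc _) i = refl

  ∷-η : (A : Matrix (suc r) n) → (A zero ∷ (A ∘ suc)) ≋ₘ A
  ∷-η A zero    i = refl
  ∷-η A (suc _) i = refl

  det : ∀ m → Matrix m m → Carrier
  det zero    A = 1#
  det (suc m) A = ± (λ j → A zero j * det m (λ r s → A (suc r) (punchIn j s)))

  infixr 6 _·_⊹_
  _·_⊹_ : Carrier → Vector Carrier n → Vector Carrier n → Vector Carrier n
  (x · u ⊹ v) i = x * u i + v i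

  Repeated : ∀ r → (Matrix (suc r) n → Carrier) → Set (c ⊔ ℓ)
  Repeated zero    f = ⊤
  Repeated (suc r) f = ∀ v A → f (v ∷ v ∷ A) ≈ 0#

  -- One equation for `x · u ⊹ v` covers additivity (x = 1) and homogeneity (see `scale-head`). Only
  -- the top rows are constrained here; the rows below are reached by fixing the top row, which
  -- suits induction on the number of rows.
  record HeadAlternating r (f : Matrix (suc r) n → Carrier) : Set (c ⊔ ℓ) where
    field
      linear   : ∀ x u v A → f ((x · u ⊹ v) ∷ A) ≈ x * f (u ∷ A) + f (v ∷ A)
      repeated : Repeated r f

  -- Only adjacent equal rows are required to kill the form.
  Alternating : ∀ r → (Matrix r n → Carrier) → Set (c ⊔ ℓ)
  Alternating zero    f = ⊤
  Alternating (suc r) f = HeadAlternating r f × (∀ v → Alternating r (λ A → f (v ∷ A)))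

  -- Rows are functions, and pointwise equal functions need not be identical, so a form must be
  -- known separately to respect pointwise equality.
  Congruent : (Matrix r n → Carrier) → Set (c ⊔ ℓ)
  Congruent f = ∀ {A B} → A ≋ₘ B → f A ≈ f B

  ∷-congruent : {f : Matrix (suc r) n → Carrier} → Congruent f → ∀ v → Congruent (λ A → f (v ∷ A))
  ∷-congruent f-cong v A≋B = f-cong (∷-cong (λ _ → refl) A≋B)

  alternating-resp : ∀ r {f g : Matrix r n → Carrier} → (∀ A → f A ≈ g A) → Alternating r f → Alternating r g
  alternating-resp zero    f≈g _ = _
  alternating-resp (suc r) {f} {g} f≈g (head , tail) = record
    { linear   = λ x u v A → trans (sym (f≈g _)) (trans (linear x u v A) (+-cong (*-congˡ (f≈g _)) (f≈g _)))
    ; repeated = repeat r f≈g repeated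
    } , λ v → alternating-resp r (λ A → f≈g (v ∷ A)) (tail v)
    where
    open HeadAlternating head
    repeat : ∀ r {f g : Matrix (suc r) n → Carrier} → (∀ A → f A ≈ g A) → Repeated r f → Repeated r g
    repeat zero    f≈g _  = _
    repeat (suc r) f≈g rp = λ v A → trans (sym (f≈g _)) (rp v A)

  -- With its top row fixed, a determinant is a combination of this shape of its minors. This is how
  -- alternation passes from one size to the next.
  alternating-± : ∀ r {k} (x : Vector Carrier k) {f : Fin k → Matrix r n → Carrier} →
    (∀ j → Alternating r (f j)) → Alternating r (λ A → ± (λ j → x j * f j A))
  alternating-± zero    x f-alt = _
  alternating-± (suc r) x {f} f-alt = record
    { linear   = λ y u v A → trans
        (±-cong (λ j → trans (*-congˡ (HeadAlternating.linear (proj₁ (f-alt j)) y u v A))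
          (solve 4 (λ x y a b → x :* (y :* a :+ b) := y :* (x :* a) :+ x :* b) refl (x j) y _ _)))
        (±-linear y _ _)
    ; repeated = repeat r (λ j → HeadAlternating.repeated (proj₁ (f-alt j)))
    } , λ v → alternating-± r x (λ j → proj₂ (f-alt j) v)
    where
    repeat : ∀ r {f : Fin _ → Matrix (suc r) n → Carrier} → (∀ j → Repeated r (f j)) → Repeated r (λ A → ± (λ j → x j * f j A))
    repeat zero    _  = _
    repeat (suc r) rp = λ v A → ±-0 (λ j → trans (*-congˡ (rp j v A)) (zeroʳ _))

  record LinearMap (k n : ℕ) : Set (c ⊔ ℓ) where
    field
      apply  : Vector Carrier k → Vector Carrier n
      cong   : ∀ {u v} → u ≋ v → apply u ≋ apply v
      linear : ∀ x u v → apply (x · u ⊹ v) ≋ x · apply u ⊹ apply v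

  -- A linear map applied to every row preserves linearity and equality of rows. It serves for
  -- deleting a column, inserting a zero column and multiplying by a matrix on the right.
  alternating-∘ : ∀ r {k} (L : LinearMap k n) {f : Matrix r n → Carrier} → Congruent f →
    Alternating r f → Alternating r (λ A → f (LinearMap.apply L ∘ A))
  alternating-∘ zero    L f-cong _ = _
  alternating-∘ (suc r) {k} L {f} f-cong (head , tail) = record
    { linear   = λ x u v A → begin
        f (apply ∘ ((x · u ⊹ v) ∷ A))                            ≈⟨ unfold _ A ⟨
        f (apply (x · u ⊹ v) ∷ (apply ∘ A))                      ≈⟨ f-cong (∷-cong (L.linear x u v) (λ _ _ → refl)) ⟩
        f ((x · apply u ⊹ apply v) ∷ (apply ∘ A))                ≈⟨ HeadAlternating.linear head x _ _ _ ⟩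
        x * f (apply u ∷ (apply ∘ A)) + f (apply v ∷ (apply ∘ A)) ≈⟨ +-cong (*-congˡ (unfold u A)) (unfold v A) ⟩
        x * f (apply ∘ (u ∷ A)) + f (apply ∘ (v ∷ A))            ∎
    ; repeated = repeat r f-cong (HeadAlternating.repeated head)
    } , λ v → alternating-resp r (unfold v) (alternating-∘ r L (∷-congruent f-cong (apply v)) (tail (apply v)))
    where
    module L = LinearMap L
    open L using (apply)
    unfold : ∀ v A → f (apply v ∷ (apply ∘ A)) ≈ f (apply ∘ (v ∷ A))
    unfold v A = f-cong (∷-map apply v A)
    repeat : ∀ r {f : Matrix (suc r) _ → Carrier} → Congruent f → Repeated r f → Repeated r (λ A → f (apply ∘ A))
    repeat zero    _      _  = _
    repeat (suc r) f-cong rp = λ v A → trans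
      (sym (f-cong (λ { zero _ → refl ; (suc zero) _ → refl ; (suc (suc _)) _ → refl })))
      (rp (apply v) (apply ∘ A))

  deleteAt : Fin (suc n) → LinearMap (suc n) n
  deleteAt j = record
    { apply  = _∘ punchIn j
    ; cong   = λ u≋v i → u≋v (punchIn j i)
    ; linear = λ x u v i → refl
    }

  det-cong : ∀ m → Congruent (det m)
  det-cong zero    A≋B = refl
  det-cong (suc m) A≋B = ±-cong (λ j → *-cong (A≋B zero j) (det-cong m (λ r s → A≋B (suc r) (punchIn j s))))

  -- Deleting column j and then k deletes the same pair as deleting k′ and then j′, where
  -- the two pairs have opposite signs: the terms of the iterated Laplace expansion cancel.
  double-expansion : ∀ m (u : Vector Carrier (suc (suc m))) (H : (Fin m → Fin (suc (suc m))) → Carrier) →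
    (∀ {c d} → (∀ s → c s ≡ d s) → H c ≈ H d) →
    ± (λ j → u j * ± (λ k → u (punchIn j k) * H (λ s → punchIn j (punchIn k s)))) ≈ 0#
  double-expansion m u H H-cong = begin
    ± (λ j → u j * ± (λ k → u (punchIn j k) * H (λ s → punchIn j (punchIn k s))))
      ≡⟨ ±-suc _ ⟩
    u zero * X - ± (λ j → u (suc j) * ± (λ k → u (punchIn (suc j) k) * H (λ s → punchIn (suc j) (punchIn k s))))
      -- The terms that delete column 0 second add up to `u zero * X`, the contribution of those
      -- that delete it first, and cancel it. The rest never deletes column 0.
      ≈⟨ +-congˡ (-‿cong (±-cong split)) ⟩
    u zero * X - ± (λ j → u zero * (u (suc j) * H (suc ∘ punchIn j)) + (- 1# * (u (suc j) * Y j) + 0#))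
      ≈⟨ +-congˡ (-‿cong (trans (±-linear (u zero) _ _) (+-congˡ (±-linear (- 1#) _ _)))) ⟩
    u zero * X - (u zero * X + (- 1# * ± (λ j → u (suc j) * Y j) + ± {suc m} (λ _ → 0#)))
      ≈⟨ +-congˡ (-‿cong (+-congˡ (+-cong (*-congˡ (rest m u H H-cong)) (±-0 {suc m} (λ _ → refl))))) ⟩
    u zero * X - (u zero * X + (- 1# * 0# + 0#))
      ≈⟨ solve 2 (λ a b → a :+ :- (a :+ (b :* con 0ℤ :+ con 0ℤ)) := con 0ℤ) refl (u zero * X) (- 1#) ⟩
    0# ∎
    where
    X = ± (λ k → u (suc k) * H (suc ∘ punchIn k))
    Y : Fin (suc m) → Carrier
    Y j = ± (λ k → u (suc (punchIn j k)) * H (λ s → punchIn (suc j) (punchIn (suc k) s)))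
    split : ∀ j → u (suc j) * ± (λ k → u (punchIn (suc j) k) * H (λ s → punchIn (suc j) (punchIn k s)))
      ≈ u zero * (u (suc j) * H (suc ∘ punchIn j)) + (- 1# * (u (suc j) * Y j) + 0#)
    split j = trans (*-congˡ (reflexive (±-suc _))) (trans
      (solve 4 (λ a b h y → a :* (b :* h :+ :- y) := b :* (a :* h) :+ :- (a :* y)) refl (u (suc j)) (u zero) _ (Y j))
      (+-congˡ (sym (trans (+-identityʳ _) (-1*x≈-x _)))))
    -- Column 0 survives every deletion here and always comes first among the remaining columns.
    -- Holding it fixed inside `H` leaves the original claim with one column fewer.
    rest : ∀ m (u : Vector Carrier (suc (suc m))) (H : (Fin m → Fin (suc (suc m))) → Carrier) →
      (∀ {c d} → (∀ s → c s ≡ d s) → H c ≈ H d) →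
      ± (λ j → u (suc j) * ± (λ k → u (suc (punchIn j k)) * H (λ s → punchIn (suc j) (punchIn (suc k) s)))) ≈ 0#
    rest zero    u H H-cong = ±-0 (λ j → trans (*-congˡ (±-0 (λ ()))) (zeroʳ _))
    rest (suc m) u H H-cong = trans
      (±-cong (λ j → *-congˡ (±-cong (λ k → *-congˡ (H-cong (λ { zero → Eq.refl ; (suc s) → Eq.refl }))))))
      (double-expansion m (u ∘ suc) (λ c → H (zero ∷ (suc ∘ c)))
        (λ c≗d → H-cong (λ { zero → Eq.refl ; (suc s) → Eq.cong suc (c≗d s) })))

  det-alternating : ∀ m → Alternating m (det m)
  det-alternating zero    = _
  det-alternating (suc m) = record
    { linear   = λ x u v A → trans
        (±-cong {suc m} (λ j → solve 4 (λ x a b d → (x :* a :+ b) :* d := x :* (a :* d) :+ b :* d) refl x (u j) (v j) _))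
        (±-linear {suc m} x _ _)
    ; repeated = repeat m
    } , λ v → alternating-± m v (λ j → alternating-∘ m (deleteAt j) (det-cong m) (det-alternating m))
    where
    repeat : ∀ m → Repeated m (det (suc m))
    repeat zero    = _
    repeat (suc m) = λ v A → double-expansion m v (λ c → det m (λ r s → A r (c s)))
      (λ c≗d → det-cong m (λ r s → reflexive (Eq.cong (A r) (c≗d s))))

  module _ {f : Matrix (suc r) n → Carrier} (f-cong : Congruent f) (f-alt : Alternating (suc r) f) where
    open HeadAlternating (proj₁ f-alt)

    -- `linear` always adds a second vector, and the zero row is not yet known to give zero. Hence x
    -- u is written as (x - 1) u + u.
    scale-head : ∀ x u A → f ((λ i → x * u i) ∷ A) ≈ x * f (u ∷ A)
    scale-head x u A = begin
      f ((λ i → x * u i) ∷ A)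
        ≈⟨ f-cong (∷-cong (λ i → solve 2 (λ x u → x :* u := (x :+ :- con 1ℤ) :* u :+ u) refl x (u i)) (λ _ _ → refl)) ⟩
      f (((x + - fromℤ 1ℤ) · u ⊹ u) ∷ A)
        ≈⟨ linear _ u u A ⟩
      (x + - fromℤ 1ℤ) * f (u ∷ A) + f (u ∷ A)
        ≈⟨ solve 2 (λ x u → (x :+ :- con 1ℤ) :* u :+ u := x :* u) refl x (f (u ∷ A)) ⟩
      x * f (u ∷ A) ∎
      where open IntegerSolver S using (fromℤ)

    zero-head : ∀ A → f ((λ i → 0#) ∷ A) ≈ 0#
    zero-head A = trans (f-cong (∷-cong (λ i → sym (zeroˡ 0#)) (λ _ _ → refl))) (trans (scale-head 0# _ A) (zeroˡ _))

    ∑-head : ∀ {k} (x : Vector Carrier k) (v : Matrix k n) A →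
      f ((λ i → ∑ (λ j → x j * v j i)) ∷ A) ≈ ∑ (λ j → x j * f (v j ∷ A))
    ∑-head {zero}  x v A = trans (f-cong (∷-cong (λ i → reflexive (∑-nil _)) (λ _ _ → refl)))
      (trans (zero-head A) (reflexive (Eq.sym (∑-nil _))))
    ∑-head {suc k} x v A = begin
      f ((λ i → ∑ (λ j → x j * v j i)) ∷ A)                                      ≈⟨ f-cong (∷-cong (λ i → reflexive (∑-suc (λ j → x j * v j i))) (λ _ _ → refl)) ⟩
      f ((x zero · v zero ⊹ (λ i → ∑ (λ j → x (suc j) * v (suc j) i))) ∷ A)      ≈⟨ linear (x zero) (v zero) _ A ⟩
      x zero * f (v zero ∷ A) + f ((λ i → ∑ (λ j → x (suc j) * v (suc j) i)) ∷ A)  ≈⟨ +-congˡ (∑-head (x ∘ suc) (v ∘ suc) A) ⟩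
      x zero * f (v zero ∷ A) + ∑ (λ j → x (suc j) * f (v (suc j) ∷ A))          ≡⟨ ∑-suc _ ⟨
      ∑ (λ j → x j * f (v j ∷ A))                                                ∎

  -- Polarisation: expand the form with u + v in both top rows, where the two terms with a repeated
  -- row vanish.
  swap : {f : Matrix (suc (suc r)) n → Carrier} → Congruent f → Alternating (suc (suc r)) f →
    ∀ u v A → f (u ∷ v ∷ A) ≈ - f (v ∷ u ∷ A)
  swap {f = f} f-cong (head , tail) u v A = +-inverseˡ-unique _ _ (begin
    f (u ∷ v ∷ A) + f (v ∷ u ∷ A)                      ≈⟨ solve 2 (λ a b → a :+ b := (con 0ℤ :+ a) :+ (b :+ con 0ℤ)) refl _ _ ⟩
    (0# + f (u ∷ v ∷ A)) + (f (v ∷ u ∷ A) + 0#)        ≈⟨ +-cong (+-congʳ (repeated u A)) (+-congˡ (repeated v A)) ⟨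
    (f (u ∷ u ∷ A) + f (u ∷ v ∷ A)) + (f (v ∷ u ∷ A) + f (v ∷ v ∷ A))  ≈⟨ +-cong (add u u v) (add v u v) ⟨
    f (u ∷ (1# · u ⊹ v) ∷ A) + f (v ∷ (1# · u ⊹ v) ∷ A)  ≈⟨ trans (linear 1# u v _) (+-congʳ (*-identityˡ _)) ⟨
    f ((1# · u ⊹ v) ∷ (1# · u ⊹ v) ∷ A)                  ≈⟨ repeated _ A ⟩
    0#                                                   ∎)
    where
    open HeadAlternating head
    add : ∀ w u v → f (w ∷ (1# · u ⊹ v) ∷ A) ≈ f (w ∷ u ∷ A) + f (w ∷ v ∷ A)
    add w u v = trans (HeadAlternating.linear (proj₁ (tail w)) 1# u v A) (+-congʳ (*-identityˡ _))

  -- Only adjacent equal rows are known to give zero. So `v` is exchanged with the next row, the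
  -- rows below are treated by induction, and `v` is exchanged back; the next row, now adjacent to
  -- `v`, needs only linearity.
  add-multiples : ∀ r {f : Matrix (suc r) n → Carrier} → Congruent f → Alternating (suc r) f →
    ∀ v A (x : Vector Carrier r) → f (v ∷ A) ≈ f (v ∷ (λ i → x i · v ⊹ A i))
  add-multiples zero    f-cong f-alt v A x = f-cong (∷-cong (λ _ → refl) (λ ()))
  add-multiples (suc r) {f} f-cong f-alt v A x = begin
    f (v ∷ A)                              ≈⟨ f-cong (∷-cong (λ _ → refl) (∷-η A)) ⟨
    f (v ∷ A zero ∷ (A ∘ suc))             ≈⟨ swap f-cong f-alt v (A zero) _ ⟩
    - f (A zero ∷ v ∷ (A ∘ suc))           ≈⟨ -‿cong (add-multiples r (∷-congruent f-cong (A zero)) (proj₂ f-alt (A zero)) v (A ∘ suc) (x ∘ suc)) ⟩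
    - f (A zero ∷ v ∷ B)                   ≈⟨ swap f-cong f-alt v (A zero) B ⟨
    f (v ∷ A zero ∷ B)                     ≈⟨ trans (+-congʳ (trans (*-congˡ (HeadAlternating.repeated (proj₁ f-alt) v B)) (zeroʳ _))) (+-identityˡ _) ⟨
    x zero * f (v ∷ v ∷ B) + f (v ∷ A zero ∷ B)  ≈⟨ HeadAlternating.linear (proj₁ (proj₂ f-alt v)) (x zero) v (A zero) B ⟨
    f (v ∷ (x zero · v ⊹ A zero) ∷ B)      ≈⟨ f-cong (∷-cong (λ _ → refl) (∷-η (λ i → x i · v ⊹ A i))) ⟩
    f (v ∷ (λ i → x i · v ⊹ A i))          ∎
    where
    B = λ i → x (suc i) · v ⊹ A (suc i)

  move-to-front : ∀ r {f : Matrix (suc r) n → Carrier} → Congruent f → Alternating (suc r) f →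
    ∀ A j → f (A j ∷ (A ∘ punchIn j)) ≈ sign j * f A
  move-to-front r       {f} f-cong f-alt A zero    = trans (f-cong (∷-η A)) (sym (*-identityˡ _))
  move-to-front (suc r) {f} f-cong f-alt A (suc j) = begin
    f (A (suc j) ∷ (A ∘ punchIn (suc j)))                ≈⟨ f-cong (∷-cong (λ _ → refl) (∷-η (A ∘ punchIn (suc j)))) ⟨
    f (A (suc j) ∷ A zero ∷ (A ∘ suc ∘ punchIn j))       ≈⟨ swap f-cong f-alt _ _ _ ⟩
    - f (A zero ∷ A (suc j) ∷ (A ∘ suc ∘ punchIn j))     ≈⟨ -‿cong (move-to-front r (∷-congruent f-cong (A zero)) (proj₂ f-alt (A zero)) (A ∘ suc) j) ⟩
    - (sign j * f (A zero ∷ (A ∘ suc)))                  ≈⟨ -‿cong (*-congˡ (f-cong (∷-η A))) ⟩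
    - (sign j * f A)                                     ≈⟨ -‿distribˡ-* _ _ ⟩
    - sign j * f A                                       ∎

  insert0 : Fin (suc n) → LinearMap n (suc n)
  insert0 j = record { apply = λ u → insertAt u j 0# ; cong = insert-cong j ; linear = insert-linear j }
    where
    insert-cong : ∀ {n} (j : Fin (suc n)) {u v : Vector Carrier n} → u ≋ v → insertAt u j 0# ≋ insertAt v j 0#
    insert-cong             zero    u≋v zero    = refl
    insert-cong             zero    u≋v (suc i) = u≋v i
    insert-cong {n = suc n} (suc j) u≋v zero    = u≋v zero
    insert-cong {n = suc n} (suc j) u≋v (suc i) = insert-cong j (u≋v ∘ suc) i
    insert-linear : ∀ {n} (j : Fin (suc n)) x u v → insertAt (x · u ⊹ v) j 0# ≋ x · insertAt u j 0# ⊹ insertAt v j 0#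
    insert-linear             zero    x u v zero    = sym (trans (+-identityʳ _) (zeroʳ x))
    insert-linear             zero    x u v (suc i) = refl
    insert-linear {n = suc n} (suc j) x u v zero    = refl
    insert-linear {n = suc n} (suc j) x u v (suc i) = insert-linear j x (u ∘ suc) (v ∘ suc) i

  -- Expanding the top row in the basis rows `δ j` reduces `f A` to the values `f (δ j ∷ A′)`. Each
  -- of these is governed by the minor of column j, so the Laplace expansion of the determinant
  -- reappears with the common factor `f δ`.
  alternating-unique : ∀ m {f : Matrix m m → Carrier} → Congruent f → Alternating m f → ∀ A → f A ≈ det m A * f δ
  alternating-unique zero    f-cong f-alt A = trans (f-cong (λ ())) (sym (*-identityˡ _))
  alternating-unique (suc m) {f} f-cong f-alt A = begin
    f A                                                    ≈⟨ f-cong (∷-η A) ⟨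
    f (A zero ∷ A′)                                        ≈⟨ f-cong (∷-cong (λ i → sym (∑-δʳ i (A zero))) (λ _ _ → refl)) ⟩
    f ((λ i → ∑ (λ j → A zero j * δ j i)) ∷ A′)            ≈⟨ ∑-head f-cong f-alt (A zero) δ A′ ⟩
    ∑ (λ j → A zero j * f (δ j ∷ A′))                      ≈⟨ ∑-cong (λ j → *-congˡ (cofactor j)) ⟩
    ∑ (λ j → A zero j * (minor j * (sign j * f δ)))        ≈⟨ ∑-cong (λ j → *-assoc _ _ _) ⟨
    ∑ (λ j → A zero j * minor j * (sign j * f δ))          ≈⟨ ∑-sign _ (f δ) ⟩
    det (suc m) A * f δ                                    ∎
    where
    A′ = A ∘ suc
    minor : Fin (suc m) → Carrier
    minor j = det m (λ r s → A (suc r) (punchIn j s))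
    δ-punchIn : ∀ {n} (j : Fin (suc n)) k → δ j (punchIn j k) ≡ 0#
    δ-punchIn             zero    k       = Eq.refl
    δ-punchIn {n = suc n} (suc j) zero    = Eq.refl
    δ-punchIn {n = suc n} (suc j) (suc k) = δ-punchIn j k
    δ-self : ∀ {n} (j : Fin n) → δ j j ≡ 1#
    δ-self zero    = Eq.refl
    δ-self (suc j) = δ-self j
    insert-self : ∀ {n} (j : Fin (suc n)) (u : Vector Carrier n) → insertAt u j 0# j ≡ 0#
    insert-self             zero    u = Eq.refl
    insert-self {n = suc n} (suc j) u = insert-self j (u ∘ suc)
    insert-punchIn : ∀ {n} (j : Fin (suc n)) (u : Vector Carrier n) k → insertAt u j 0# (punchIn j k) ≡ u k
    insert-punchIn             zero    u k       = Eq.refl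
    insert-punchIn {n = suc n} (suc j) u zero    = Eq.refl
    insert-punchIn {n = suc n} (suc j) u (suc k) = insert-punchIn j (u ∘ suc) k
    δ-sym-punchIn : ∀ {n} (j : Fin (suc n)) k → δ (punchIn j k) j ≡ 0#
    δ-sym-punchIn             zero    k       = Eq.refl
    δ-sym-punchIn {n = suc n} (suc j) zero    = Eq.refl
    δ-sym-punchIn {n = suc n} (suc j) (suc k) = δ-sym-punchIn j k
    δ-punchIn² : ∀ {n} (j : Fin (suc n)) k l → δ (punchIn j k) (punchIn j l) ≡ δ k l
    δ-punchIn²             zero    k       l       = Eq.refl
    δ-punchIn² {n = suc n} (suc j) zero    zero    = Eq.refl
    δ-punchIn² {n = suc n} (suc j) zero    (suc l) = Eq.refl
    δ-punchIn² {n = suc n} (suc j) (suc k) zero    = Eq.refl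
    δ-punchIn² {n = suc n} (suc j) (suc k) (suc l) = δ-punchIn² j k l

    clear : ∀ j (u : Vector Carrier (suc m)) → (- u j · δ j ⊹ u) ≋ insertAt (u ∘ punchIn j) j 0#
    clear j u = punchIn-elim (λ i → - u j * δ j i + u i ≈ insertAt (u ∘ punchIn j) j 0# i) j
      (trans (+-congʳ (trans (*-congˡ (reflexive (δ-self j))) (*-identityʳ _)))
        (trans (-‿inverseˡ _) (reflexive (Eq.sym (insert-self j _)))))
      (λ k → trans (+-congʳ (trans (*-congˡ (reflexive (δ-punchIn j k))) (zeroʳ _)))
        (trans (+-identityˡ _) (reflexive (Eq.sym (insert-punchIn j _ k)))))

    insert-δ : ∀ j k → insertAt (δ k) j 0# ≋ δ (punchIn j k)
    insert-δ j k = punchIn-elim (λ i → insertAt (δ k) j 0# i ≈ δ (punchIn j k) i) j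
      (reflexive (Eq.trans (insert-self j (δ k)) (Eq.sym (δ-sym-punchIn j k))))
      (λ l → reflexive (Eq.trans (insert-punchIn j (δ k) l) (Eq.sym (δ-punchIn² j k l))))

    -- Subtracting multiples of the top row `δ j` clears column j below it. What remains is an
    -- alternating form in the rows of the minor, to which induction applies; its value at the
    -- identity is `f` of the identity matrix with row j moved to the top, hence the sign.
    cofactor : ∀ j → f (δ j ∷ A′) ≈ minor j * (sign j * f δ)
    cofactor j = begin
      f (δ j ∷ A′)                                         ≈⟨ add-multiples m f-cong f-alt (δ j) A′ (λ i → - A′ i j) ⟩
      f (δ j ∷ (λ i → - A′ i j · δ j ⊹ A′ i))              ≈⟨ f-cong (∷-cong (λ _ → refl) (λ i → clear j (A′ i))) ⟩
      f (δ j ∷ (λ i → insertAt (A′ i ∘ punchIn j) j 0#))   ≈⟨ alternating-unique m g-cong g-alt _ ⟩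
      minor j * f (δ j ∷ (λ k → insertAt (δ k) j 0#))      ≈⟨ *-congˡ (f-cong (∷-cong (λ _ → refl) (insert-δ j))) ⟩
      minor j * f (δ j ∷ (δ ∘ punchIn j))                  ≈⟨ *-congˡ (move-to-front m f-cong f-alt δ j) ⟩
      minor j * (sign j * f δ)                             ∎
      where
      g-cong : Congruent (λ B → f (δ j ∷ (λ i → insertAt (B i) j 0#)))
      g-cong B≋C = f-cong (∷-cong (λ _ → refl) (λ i → LinearMap.cong (insert0 j) (B≋C i)))
      g-alt : Alternating m (λ B → f (δ j ∷ (λ i → insertAt (B i) j 0#)))
      g-alt = alternating-∘ m (insert0 j) (∷-congruent f-cong (δ j)) (proj₂ f-alt (δ j))

  -- Right multiplication by `B` is linear on rows, so the determinant of the product is an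
  -- alternating form in `A`, and its value at the identity is the determinant of `B`.
  det-⊠ : ∀ m (A B : Mat S m) → det m (A ⊠ B) ≈ det m A * det m B
  det-⊠ m A B = begin
    det m (A ⊠ B)            ≈⟨ alternating-unique m f-cong (alternating-∘ m ·B (det-cong m) (det-alternating m)) A ⟩
    det m A * det m (δ ⊠ B)  ≈⟨ *-congˡ (det-cong m (λ i j → ∑-δˡ i (λ k → B k j))) ⟩
    det m A * det m B             ∎
    where
    ·B : LinearMap m m
    ·B = record
      { apply  = λ u j → ∑ (λ k → u k * B k j)
      ; cong   = λ u≋v j → ∑-cong (λ k → *-congʳ (u≋v k))
      ; linear = λ x u v j → trans
          (∑-cong (λ k → solve 4 (λ x u v b → (x :* u :+ v) :* b := x :* (u :* b) :+ v :* b) refl x (u k) (v k) (B k j)))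
          (∑-linear x _ _)
      }
    f-cong : Congruent (λ A → det m (A ⊠ B))
    f-cong A≋C = det-cong m (λ i → LinearMap.cong ·B (A≋C i))

  ∑-neg : (f : Vector Carrier n) → ∑ (λ i → - f i) ≈ - ∑ f
  ∑-neg f = trans (∑-cong (λ i → sym (-1*x≈-x (f i)))) (trans (∑-*ˡ (- 1#) f) (-1*x≈-x _))

  ±-single : (f : Vector Carrier (suc n)) (j : Fin (suc n)) → (∀ k → f (punchIn j k) ≈ 0#) → ± f ≈ sign j * f j
  ±-single f zero fk≈0 = begin
    ± f                     ≡⟨ ±-suc f ⟩
    f zero - ± (f ∘ suc)    ≈⟨ +-congˡ (trans (-‿cong (±-0 fk≈0)) -0#≈0#) ⟩
    f zero + 0#             ≈⟨ trans (+-identityʳ _) (sym (*-identityˡ _)) ⟩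
    1# * f zero             ∎
  ±-single {suc n} f (suc j) fk≈0 = begin
    ± f                           ≡⟨ ±-suc f ⟩
    f zero - ± (f ∘ suc)          ≈⟨ +-cong (fk≈0 zero) (-‿cong (±-single (f ∘ suc) j (fk≈0 ∘ suc))) ⟩
    0# - sign j * f (suc j)       ≈⟨ +-identityˡ _ ⟩
    - (sign j * f (suc j))        ≈⟨ -‿distribˡ-* _ _ ⟩
    - sign j * f (suc j)          ∎

  det-δ : ∀ m → det m δ ≈ 1#
  det-δ zero    = refl
  det-δ (suc m) = begin
    det (suc m) δ     ≈⟨ ±-single _ zero (λ k → zeroˡ _) ⟩
    1# * (1# * det m δ)  ≈⟨ trans (*-identityˡ _) (*-identityˡ _) ⟩
    det m δ           ≈⟨ det-δ m ⟩
    1#                ∎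

  Unit : Carrier → Set (c ⊔ ℓ)
  Unit x = ∃ λ y → x * y ≈ 1#

  unit-resp : ∀ {x y} → x ≈ y → Unit x → Unit y
  unit-resp x≈y (z , xz≈1) = z , trans (*-congʳ (sym x≈y)) xz≈1

  unit-* : ∀ {x y} → Unit x → Unit y → Unit (x * y)
  unit-* {x} {y} (x′ , xx′≈1) (y′ , yy′≈1) = x′ * y′ ,
    trans (solve 4 (λ x y x′ y′ → x :* y :* (x′ :* y′) := x :* x′ :* (y :* y′)) refl x y x′ y′)
      (trans (*-cong xx′≈1 yy′≈1) (*-identityˡ 1#))

  unit-neg : ∀ {x} → Unit x → Unit (- x)
  unit-neg {x} (y , xy≈1) = - y , trans (solve 2 (λ x y → :- x :* :- y := x :* y) refl x y) xy≈1

  unit-sign : ∀ (i : Fin n) → Unit (sign i)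
  unit-sign zero    = 1# , *-identityˡ 1#
  unit-sign (suc i) = unit-neg (unit-sign i)

  unit-cancel : ∀ {u x y} → Unit u → u * x ≈ y * u → x ≈ y
  unit-cancel {u} {x} {y} (v , uv≈1) ux≈yu = begin
    x            ≈⟨ *-identityˡ x ⟨
    1# * x       ≈⟨ *-congʳ uv≈1 ⟨
    u * v * x    ≈⟨ solve 3 (λ u v x → u :* v :* x := v :* (u :* x)) refl u v x ⟩
    v * (u * x)  ≈⟨ *-congˡ ux≈yu ⟩
    v * (y * u)  ≈⟨ solve 3 (λ u v y → v :* (y :* u) := y :* (u :* v)) refl u v y ⟩
    y * (u * v)  ≈⟨ trans (*-congˡ uv≈1) (*-identityʳ y) ⟩
    y            ∎

  -- Characteristic matrices x·1 - A

  charMat : Carrier → Mat S n → Mat S n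
  charMat x A i j = x * δ i j - A i j

  charMat-cong : ∀ x {A B : Mat S n} → A ≋ₘ B → charMat x A ≋ₘ charMat x B
  charMat-cong x A≋B i j = +-congˡ (-‿cong (A≋B i j))

  ⊠-charMat : ∀ x (K B : Mat S n) i j → (K ⊠ charMat x B) i j ≈ x * K i j - (K ⊠ B) i j
  ⊠-charMat x K B i j = begin
    ∑ (λ k → K i k * (x * δ k j - B k j))             ≈⟨ ∑-cong (λ k → solve 4 (λ x a d b → a :* (x :* d :+ :- b) := x :* (a :* d) :+ :- (a :* b)) refl x (K i k) (δ k j) (B k j)) ⟩
    ∑ (λ k → x * (K i k * δ k j) + - (K i k * B k j)) ≈⟨ ∑-linear x _ _ ⟩
    x * ∑ (λ k → K i k * δ k j) + ∑ (λ k → - (K i k * B k j))  ≈⟨ +-cong (*-congˡ (∑-δʳ j (K i))) (∑-neg _) ⟩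
    x * K i j - (K ⊠ B) i j                           ∎

  charMat-⊠ : ∀ x (A K : Mat S n) i j → (charMat x A ⊠ K) i j ≈ x * K i j - (A ⊠ K) i j
  charMat-⊠ x A K i j = begin
    ∑ (λ k → (x * δ i k - A i k) * K k j)             ≈⟨ ∑-cong (λ k → solve 4 (λ x a d b → (x :* d :+ :- b) :* a := x :* (d :* a) :+ :- (b :* a)) refl x (K k j) (δ i k) (A i k)) ⟩
    ∑ (λ k → x * (δ i k * K k j) + - (A i k * K k j)) ≈⟨ ∑-linear x _ _ ⟩
    x * ∑ (λ k → δ i k * K k j) + ∑ (λ k → - (A i k * K k j))  ≈⟨ +-cong (*-congˡ (∑-δˡ i (λ k → K k j))) (∑-neg _) ⟩
    x * K i j - (A ⊠ K) i j                           ∎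

  -- K B = A K implies K (x - B) = (x - A) K. Taking determinants first lets the scalar det K be
  -- cancelled, so no inverse matrix has to be constructed.
  charMat-similar : ∀ m x {A B K : Mat S m} → Unit (det m K) → (K ⊠ B) ≋ₘ (A ⊠ K) →
    det m (charMat x B) ≈ det m (charMat x A)
  charMat-similar m x {A} {B} {K} K-unit KB≋AK = unit-cancel K-unit (begin
    det m K * det m (charMat x B)    ≈⟨ det-⊠ m K (charMat x B) ⟨
    det m (K ⊠ charMat x B)          ≈⟨ det-cong m (λ i j → trans (⊠-charMat x K B i j)
                                          (trans (+-congˡ (-‿cong (KB≋AK i j))) (sym (charMat-⊠ x A K i j)))) ⟩
    det m (charMat x A ⊠ K)          ≈⟨ det-⊠ m (charMat x A) K ⟩
    det m (charMat x A) * det m K    ∎)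

  charMat-block : ∀ m x (A : Mat S (suc m)) → (∀ j → A zero (suc j) ≈ 0#) →
    det (suc m) (charMat x A) ≈ (x - A zero zero) * det m (charMat x (λ i j → A (suc i) (suc j)))
  charMat-block m x A A₀≈0 = begin
    det (suc m) (charMat x A)
      ≈⟨ ±-single _ zero (λ j → trans (*-congʳ (row₀ j)) (zeroˡ _)) ⟩
    1# * ((x * 1# - A zero zero) * det m (charMat x (λ i j → A (suc i) (suc j))))
      ≈⟨ trans (*-identityˡ _) (*-congʳ (+-congʳ (*-identityʳ x))) ⟩
    (x - A zero zero) * det m (charMat x (λ i j → A (suc i) (suc j)))  ∎
    where
    row₀ : ∀ j → charMat x A zero (suc j) ≈ 0#
    row₀ j = trans (+-cong (zeroʳ x) (trans (-‿cong (A₀≈0 j)) -0#≈0#)) (+-identityˡ 0#)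

  -- Determinants under ring homomorphisms

  module _ {h : Carrier → Carrier} (h-hom : RingMorphisms.IsRingHomomorphism rawRing rawRing h) where
    open RingMorphisms.IsRingHomomorphism h-hom

    hom-δ : ∀ (i j : Fin n) → h (δ i j) ≈ δ i j
    hom-δ i j with does (i Fin.≟ j)
    ... | true  = 1#-homo
    ... | false = 0#-homo

    opaque
      unfolding ±

      hom-± : (f : Vector Carrier n) → h (± f) ≈ ± (h ∘ f)
      hom-± {zero}  f = 0#-homo
      hom-± {suc n} f = trans (+-homo _ _) (+-congˡ (trans (-‿homo _) (-‿cong (hom-± (f ∘ suc)))))

    hom-∑ : (f : Vector Carrier n) → h (∑ f) ≈ ∑ (h ∘ f)
    hom-∑ {zero}  f = trans (⟦⟧-cong (reflexive (∑-nil f))) (trans 0#-homo (reflexive (Eq.sym (∑-nil _))))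
    hom-∑ {suc n} f = trans (⟦⟧-cong (reflexive (∑-suc f)))
      (trans (+-homo _ _) (trans (+-congˡ (hom-∑ (f ∘ suc))) (reflexive (Eq.sym (∑-suc _)))))

    hom-det : ∀ m A → h (det m A) ≈ det m (λ i j → h (A i j))
    hom-det zero    A = 1#-homo
    hom-det (suc m) A = trans (hom-± _)
      (±-cong (λ j → trans (*-homo _ _) (*-congˡ (hom-det m (λ r s → A (suc r) (punchIn j s))))))

-- The polynomial ring on coefficient lists

module Polynomials {c ℓ} (R : CommutativeRing c ℓ) where
  open import Data.List.Base using ([]; _∷_; map)
  open CommutativeRing R hiding (zero)
  open import Algebra.Properties.Ring ring
  open import Relation.Binary.Reasoning.Setoid setoid
  open IntegerSolver R using (solve; _:=_; _:+_; _:*_; :-_; con)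

  infix 4 _≈ₚ_
  -- Trailing zeros give one polynomial many lists, so equality compares coefficients. Being a
  -- record, and not a bare function type, it lets unification recover `p` and `q`.
  record _≈ₚ_ (p q : Poly R) : Set ℓ where
    constructor coeffs
    field at : ∀ i → coeff R p i ≈ coeff R q i
  open _≈ₚ_ public

  infixl 6 _⊕_
  infixl 7 _⊗_
  _⊕_ _⊗_ : Poly R → Poly R → Poly R
  _⊕_ = padd R
  _⊗_ = pmul R

  shift : Poly R → Poly R
  shift p = 0# ∷ p

  ⊕-coeff : ∀ p q i → coeff R (p ⊕ q) i ≈ coeff R p i + coeff R q i
  ⊕-coeff []      q       i       = sym (+-identityˡ _)
  ⊕-coeff (a ∷ p) []      i       = sym (+-identityʳ _)
  ⊕-coeff (a ∷ p) (b ∷ q) zero    = refl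
  ⊕-coeff (a ∷ p) (b ∷ q) (suc i) = ⊕-coeff p q i

  map-coeff : ∀ {f : Carrier → Carrier} → f 0# ≈ 0# → ∀ p i → coeff R (map f p) i ≈ f (coeff R p i)
  map-coeff f0 []      i       = sym f0
  map-coeff f0 (a ∷ p) zero    = refl
  map-coeff f0 (a ∷ p) (suc i) = map-coeff f0 p i

  neg-coeff : ∀ p i → coeff R (pneg R p) i ≈ - coeff R p i
  neg-coeff = map-coeff -0#≈0#

  scale-coeff : ∀ a p i → coeff R (map (a *_) p) i ≈ a * coeff R p i
  scale-coeff a = map-coeff (zeroʳ a)

  ⊗-coeff : ∀ a p q i → coeff R ((a ∷ p) ⊗ q) i ≈ a * coeff R q i + coeff R (shift (p ⊗ q)) i
  ⊗-coeff a p q i = trans (⊕-coeff (map (a *_) q) _ i) (+-congʳ (scale-coeff a q i))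

  ∷-congₚ : ∀ {a b p q} → a ≈ b → p ≈ₚ q → a ∷ p ≈ₚ b ∷ q
  ∷-congₚ a≈b p≈q .at zero    = a≈b
  ∷-congₚ a≈b p≈q .at (suc i) = p≈q .at i

  ≈ₚ-refl : ∀ {p} → p ≈ₚ p
  ≈ₚ-refl .at i = refl

  ≈ₚ-sym : ∀ {p q} → p ≈ₚ q → q ≈ₚ p
  ≈ₚ-sym p≈q .at i = sym (p≈q .at i)

  ≈ₚ-trans : ∀ {p q r} → p ≈ₚ q → q ≈ₚ r → p ≈ₚ r
  ≈ₚ-trans p≈q q≈r .at i = trans (p≈q .at i) (q≈r .at i)

  ⊕-cong : ∀ {p p′ q q′} → p ≈ₚ p′ → q ≈ₚ q′ → p ⊕ q ≈ₚ p′ ⊕ q′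
  ⊕-cong {p} {p′} {q} {q′} e f .at i =
    trans (⊕-coeff p q i) (trans (+-cong (e .at i) (f .at i)) (sym (⊕-coeff p′ q′ i)))

  pneg-cong : ∀ {p q} → p ≈ₚ q → pneg R p ≈ₚ pneg R q
  pneg-cong {p} {q} e .at i = trans (neg-coeff p i) (trans (-‿cong (e .at i)) (sym (neg-coeff q i)))

  ⊕-assoc : ∀ p q r → (p ⊕ q) ⊕ r ≈ₚ p ⊕ (q ⊕ r)
  ⊕-assoc p q r .at i = begin
    coeff R ((p ⊕ q) ⊕ r) i                      ≈⟨ trans (⊕-coeff (p ⊕ q) r i) (+-congʳ (⊕-coeff p q i)) ⟩
    coeff R p i + coeff R q i + coeff R r i      ≈⟨ +-assoc _ _ _ ⟩
    coeff R p i + (coeff R q i + coeff R r i)    ≈⟨ trans (⊕-coeff p (q ⊕ r) i) (+-congˡ (⊕-coeff q r i)) ⟨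
    coeff R (p ⊕ (q ⊕ r)) i                      ∎

  ⊕-comm : ∀ p q → p ⊕ q ≈ₚ q ⊕ p
  ⊕-comm p q .at i = trans (⊕-coeff p q i) (trans (+-comm _ _) (sym (⊕-coeff q p i)))

  ⊕-identityʳ : ∀ p → p ⊕ [] ≈ₚ p
  ⊕-identityʳ p .at i = trans (⊕-coeff p [] i) (+-identityʳ _)

  pneg-inverseˡ : ∀ p → pneg R p ⊕ p ≈ₚ []
  pneg-inverseˡ p .at i = trans (⊕-coeff (pneg R p) p i) (trans (+-congʳ (neg-coeff p i)) (-‿inverseˡ _))

  ⊗-congˡ : ∀ p {q r} → q ≈ₚ r → p ⊗ q ≈ₚ p ⊗ r
  ⊗-congˡ []      q≈r = ≈ₚ-refl
  ⊗-congˡ (a ∷ p) {q} {r} q≈r .at i = begin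
    coeff R ((a ∷ p) ⊗ q) i                          ≈⟨ ⊗-coeff a p q i ⟩
    a * coeff R q i + coeff R (shift (p ⊗ q)) i      ≈⟨ +-cong (*-congˡ (q≈r .at i)) (∷-congₚ refl (⊗-congˡ p q≈r) .at i) ⟩
    a * coeff R r i + coeff R (shift (p ⊗ r)) i      ≈⟨ ⊗-coeff a p r i ⟨
    coeff R ((a ∷ p) ⊗ r) i                          ∎

  ⊗-zeroʳ : ∀ p → p ⊗ [] ≈ₚ []
  ⊗-zeroʳ []      = ≈ₚ-refl
  ⊗-zeroʳ (a ∷ p) .at zero    = refl
  ⊗-zeroʳ (a ∷ p) .at (suc i) = ⊗-zeroʳ p .at i

  -- `pmul` recurses on its left factor. This is the matching recursion on the right factor, and
  -- commutativity follows by comparing the two.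
  ⊗-∷ʳ : ∀ p b q → p ⊗ (b ∷ q) ≈ₚ map (b *_) p ⊕ shift (p ⊗ q)
  ⊗-∷ʳ []      b q .at zero    = refl
  ⊗-∷ʳ []      b q .at (suc i) = refl
  ⊗-∷ʳ (a ∷ p) b q .at zero    = +-congʳ (*-comm a b)
  ⊗-∷ʳ (a ∷ p) b q .at (suc i) = begin
    coeff R (map (a *_) q ⊕ p ⊗ (b ∷ q)) i                              ≈⟨ ⊕-coeff (map (a *_) q) _ i ⟩
    coeff R (map (a *_) q) i + coeff R (p ⊗ (b ∷ q)) i                  ≈⟨ +-congˡ (trans (⊗-∷ʳ p b q .at i) (⊕-coeff (map (b *_) p) _ i)) ⟩
    coeff R (map (a *_) q) i + (coeff R (map (b *_) p) i + coeff R (shift (p ⊗ q)) i)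
      ≈⟨ solve 3 (λ x y z → x :+ (y :+ z) := y :+ (x :+ z)) refl _ _ _ ⟩
    coeff R (map (b *_) p) i + (coeff R (map (a *_) q) i + coeff R (shift (p ⊗ q)) i)
      ≈⟨ trans (⊕-coeff (map (b *_) p) _ i) (+-congˡ (⊕-coeff (map (a *_) q) _ i)) ⟨
    coeff R (map (b *_) p ⊕ (a ∷ p) ⊗ q) i                              ∎

  ⊗-comm : ∀ p q → p ⊗ q ≈ₚ q ⊗ p
  ⊗-comm []      q = ≈ₚ-sym (⊗-zeroʳ q)
  ⊗-comm (a ∷ p) q = ≈ₚ-trans (⊕-cong {map (a *_) q} ≈ₚ-refl (∷-congₚ refl (⊗-comm p q))) (≈ₚ-sym (⊗-∷ʳ q a p))

  -- Equal left factors may be lists of different lengths, on which a parallel induction gets stuck;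
  -- commutativity carries `⊗-congˡ` over to them.
  ⊗-cong : ∀ {p p′ q q′} → p ≈ₚ p′ → q ≈ₚ q′ → p ⊗ q ≈ₚ p′ ⊗ q′
  ⊗-cong {p} {p′} {q} {q′} e f = ≈ₚ-trans (⊗-congˡ p f)
    (≈ₚ-trans (⊗-comm p q′) (≈ₚ-trans (⊗-congˡ q′ e) (⊗-comm q′ p′)))

  ⊗-distribˡ : ∀ p q r → p ⊗ (q ⊕ r) ≈ₚ p ⊗ q ⊕ p ⊗ r
  ⊗-distribˡ []      q r = ≈ₚ-refl
  ⊗-distribˡ (a ∷ p) q r .at i = begin
    coeff R ((a ∷ p) ⊗ (q ⊕ r)) i                                      ≈⟨ ⊗-coeff a p (q ⊕ r) i ⟩
    a * coeff R (q ⊕ r) i + coeff R (shift (p ⊗ (q ⊕ r))) i            ≈⟨ +-cong (*-congˡ (⊕-coeff q r i)) (shifted i) ⟩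
    a * (coeff R q i + coeff R r i) + (coeff R (shift (p ⊗ q)) i + coeff R (shift (p ⊗ r)) i)
      ≈⟨ solve 5 (λ a q r x y → a :* (q :+ r) :+ (x :+ y) := (a :* q :+ x) :+ (a :* r :+ y)) refl a _ _ _ _ ⟩
    (a * coeff R q i + coeff R (shift (p ⊗ q)) i) + (a * coeff R r i + coeff R (shift (p ⊗ r)) i)
      ≈⟨ trans (⊕-coeff ((a ∷ p) ⊗ q) _ i) (+-cong (⊗-coeff a p q i) (⊗-coeff a p r i)) ⟨
    coeff R ((a ∷ p) ⊗ q ⊕ (a ∷ p) ⊗ r) i                              ∎
    where
    shifted : ∀ i → coeff R (shift (p ⊗ (q ⊕ r))) i ≈ coeff R (shift (p ⊗ q)) i + coeff R (shift (p ⊗ r)) i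
    shifted zero    = sym (+-identityʳ 0#)
    shifted (suc i) = trans (⊗-distribˡ p q r .at i) (⊕-coeff (p ⊗ q) _ i)

  ⊗-distribʳ : ∀ p q r → (q ⊕ r) ⊗ p ≈ₚ q ⊗ p ⊕ r ⊗ p
  ⊗-distribʳ p q r = ≈ₚ-trans (⊗-comm (q ⊕ r) p)
    (≈ₚ-trans (⊗-distribˡ p q r) (⊕-cong (⊗-comm p q) (⊗-comm p r)))

  scale-⊗ : ∀ a p q → map (a *_) p ⊗ q ≈ₚ map (a *_) (p ⊗ q)
  scale-⊗ a []      q = ≈ₚ-refl
  scale-⊗ a (b ∷ p) q .at i = begin
    coeff R ((a * b ∷ map (a *_) p) ⊗ q) i                             ≈⟨ ⊗-coeff (a * b) (map (a *_) p) q i ⟩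
    a * b * coeff R q i + coeff R (shift (map (a *_) p ⊗ q)) i         ≈⟨ +-cong (*-assoc _ _ _) (shifted i) ⟩
    a * (b * coeff R q i) + a * coeff R (shift (p ⊗ q)) i              ≈⟨ distribˡ _ _ _ ⟨
    a * (b * coeff R q i + coeff R (shift (p ⊗ q)) i)                  ≈⟨ trans (scale-coeff a ((b ∷ p) ⊗ q) i) (*-congˡ (⊗-coeff b p q i)) ⟨
    coeff R (map (a *_) ((b ∷ p) ⊗ q)) i                               ∎
    where
    shifted : ∀ i → coeff R (shift (map (a *_) p ⊗ q)) i ≈ a * coeff R (shift (p ⊗ q)) i
    shifted zero    = sym (zeroʳ a)
    shifted (suc i) = trans (scale-⊗ a p q .at i) (scale-coeff a (p ⊗ q) i)

  shift-⊗ : ∀ p q → shift p ⊗ q ≈ₚ shift (p ⊗ q)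
  shift-⊗ p q .at i = trans (⊗-coeff 0# p q i) (trans (+-congʳ (zeroˡ _)) (+-identityˡ _))

  ⊗-assoc : ∀ p q r → (p ⊗ q) ⊗ r ≈ₚ p ⊗ (q ⊗ r)
  ⊗-assoc []      q r = ≈ₚ-refl
  ⊗-assoc (a ∷ p) q r = ≈ₚ-trans (⊗-distribʳ r (map (a *_) q) (shift (p ⊗ q)))
    (⊕-cong (scale-⊗ a q r) (≈ₚ-trans (shift-⊗ (p ⊗ q) r) (∷-congₚ refl (⊗-assoc p q r))))

  ⊗-identityˡ : ∀ p → pconst R 1# ⊗ p ≈ₚ p
  ⊗-identityˡ p .at i = trans (⊗-coeff 1# [] p i) (trans (+-cong (*-identityˡ _) (shifted i)) (+-identityʳ _))
    where
    shifted : ∀ i → coeff R (shift []) i ≈ 0#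
    shifted zero    = refl
    shifted (suc i) = refl

  polyRing : CommutativeRing c ℓ
  polyRing = record
    { Carrier = Poly R ; _≈_ = _≈ₚ_ ; _+_ = _⊕_ ; _*_ = _⊗_ ; -_ = pneg R ; 0# = [] ; 1# = pconst R 1#
    ; isCommutativeRing = record
      { isRing = record
        { +-isAbelianGroup = record
          { isGroup = record
            { isMonoid = record
              { isSemigroup = record
                { isMagma = record
                  { isEquivalence = record { refl = ≈ₚ-refl ; sym = ≈ₚ-sym ; trans = ≈ₚ-trans }
                  ; ∙-cong = ⊕-cong }
                ; assoc = ⊕-assoc }
              ; identity = (λ p → ≈ₚ-refl) , ⊕-identityʳ }
            ; inverse = pneg-inverseˡ , λ p → ≈ₚ-trans (⊕-comm p _) (pneg-inverseˡ p)
            ; ⁻¹-cong = pneg-cong }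
          ; comm = ⊕-comm }
        ; *-cong = ⊗-cong
        ; *-assoc = ⊗-assoc
        ; *-identity = ⊗-identityˡ , λ p → ≈ₚ-trans (⊗-comm p _) (⊗-identityˡ p)
        ; distrib = ⊗-distribˡ , ⊗-distribʳ }
      ; *-comm = ⊗-comm } }

-- Characteristic polynomials and the companion matrix

toℕ-punchIn-fromℕ : ∀ n (i : Fin n) → toℕ (punchIn (fromℕ n) i) ≡ toℕ i
toℕ-punchIn-fromℕ (suc n) zero    = Eq.refl
toℕ-punchIn-fromℕ (suc n) (suc i) = Eq.cong suc (toℕ-punchIn-fromℕ n i)

does-toℕ-≟ : ∀ {n} (i j : Fin n) → does (toℕ i ℕ.≟ toℕ j) ≡ does (i Fin.≟ j)
does-toℕ-≟ zero    zero    = Eq.refl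
does-toℕ-≟ zero    (suc j) = Eq.refl
does-toℕ-≟ (suc i) zero    = Eq.refl
does-toℕ-≟ (suc i) (suc j) = does-toℕ-≟ i j

module CharacteristicPolynomial {c ℓ} (R : CommutativeRing c ℓ) where
  open import Data.List.Base using ([]; _∷_; map)
  open CommutativeRing R hiding (zero)
  open import Algebra.Properties.Ring ring
  open Polynomials R
  module P = CommutativeRing polyRing
  module M = Determinant R
  module D = Determinant polyRing
  open RingMorphisms rawRing rawRing

  κ : Carrier → Poly R
  κ = pconst R

  X : Poly R
  X = pX R

  κ-cong : ∀ {x y} → x ≈ y → κ x ≈ₚ κ y
  κ-cong x≈y = ∷-congₚ x≈y ≈ₚ-refl

  κ-0 : κ 0# ≈ₚ []
  κ-0 .at zero    = refl
  κ-0 .at (suc i) = refl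

  κ-* : ∀ x y → κ (x * y) ≈ₚ κ x ⊗ κ y
  κ-* x y .at zero    = sym (+-identityʳ _)
  κ-* x y .at (suc i) = refl

  κ-∑ : ∀ {n} (f : Fin n → Carrier) → κ (M.∑ f) ≈ₚ D.∑ (κ ∘ f)
  κ-∑ {zero}  f = ≈ₚ-trans (κ-cong (reflexive (M.∑-nil f))) (≈ₚ-trans κ-0 (P.reflexive (Eq.sym (D.∑-nil _))))
  κ-∑ {suc n} f = ≈ₚ-trans (κ-cong (reflexive (M.∑-suc f)))
    (≈ₚ-trans (⊕-cong {κ (f zero)} ≈ₚ-refl (κ-∑ (f ∘ suc))) (P.reflexive (Eq.sym (D.∑-suc _))))

  κ-⊠ : ∀ {n} (A B : Mat R n) i j → κ ((A M.⊠ B) i j) ≈ₚ ((λ i j → κ (A i j)) D.⊠ (λ i j → κ (B i j))) i j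
  κ-⊠ A B i j = ≈ₚ-trans (κ-∑ (λ k → A i k * B k j)) (D.∑-cong (λ k → κ-* (A i k) (B k j)))

  κ-unit : ∀ {x} → M.Unit x → D.Unit (κ x)
  κ-unit {x} (y , xy≈1) = κ y , ≈ₚ-trans (≈ₚ-sym (κ-* x y)) (κ-cong xy≈1)

  psum-cong : ∀ {n} {f g : Fin n → Poly R} → (∀ i → f i ≈ₚ g i) → psum R f ≈ₚ psum R g
  psum-cong {zero}  f≈g = ≈ₚ-refl
  psum-cong {suc n} f≈g = ⊕-cong (f≈g zero) (psum-cong (f≈g ∘ suc))

  opaque
    unfolding D.±

    -- `pdet` takes its signs from the parity of the index, `±` from nested subtraction. Passing to
    -- the tail reverses parity, so the version with opposite signs is proved simultaneously.
    psum-± : ∀ {n} (f : Fin n → Poly R) →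
      psum R (λ i → if isEven R (toℕ i) then f i else pneg R (f i)) ≈ₚ D.± f
    psum-±′ : ∀ {n} (f : Fin n → Poly R) →
      psum R (λ i → if not (isEven R (toℕ i)) then f i else pneg R (f i)) ≈ₚ pneg R (D.± f)
    psum-± {zero}  f = ≈ₚ-refl
    psum-± {suc n} f = ⊕-cong {f zero} ≈ₚ-refl (psum-±′ (f ∘ suc))
    psum-±′ {zero}  f = ≈ₚ-refl
    psum-±′ {suc n} f = ≈ₚ-trans
      (⊕-cong {pneg R (f zero)} ≈ₚ-refl (≈ₚ-trans
        (psum-cong {n} (λ i → P.reflexive (Eq.cong (if_then f (suc i) else pneg R (f (suc i))) (Bool.not-involutive _))))
        (psum-± (f ∘ suc))))
      (≈ₚ-trans (⊕-cong {pneg R (f zero)} ≈ₚ-refl (≈ₚ-sym (-‿involutiveₚ _))) (-‿+-commₚ (f zero) _))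
      where open import Algebra.Properties.Ring P.ring using () renaming (-‿involutive to -‿involutiveₚ; -‿+-comm to -‿+-commₚ)

  pdet≈det : ∀ m {A : Fin m → Fin m → Poly R} {B} → A D.≋ₘ B → pdet R m A ≈ₚ D.det m B
  pdet≈det zero    A≈B = ≈ₚ-refl
  pdet≈det (suc m) A≈B = ≈ₚ-trans (psum-± {suc m} _)
    (D.±-cong (λ j → ⊗-cong (A≈B zero j) (pdet≈det m (λ r s → A≈B (suc r) (punchIn j s)))))

  charMat : ∀ {m} → Mat R m → Mat polyRing m
  charMat A = D.charMat X (λ i j → κ (A i j))

  charPoly≈det : ∀ m A → charPoly R m A ≈ₚ D.det m (charMat A)
  charPoly≈det m A = pdet≈det m entry
    where
    entry : ∀ i j → (if does (i Fin.≟ j) then X ⊕ pneg R (κ (A i j)) else pneg R (κ (A i j))) ≈ₚ charMat A i j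
    entry i j with does (i Fin.≟ j)
    ... | true  = ⊕-cong {q = pneg R (κ (A i j))} (≈ₚ-sym (P.*-identityʳ X)) ≈ₚ-refl
    ... | false = ⊕-cong {[]} (≈ₚ-sym (⊗-zeroʳ X)) ≈ₚ-refl

  charPoly-cong : ∀ m {A B : Mat R m} → A M.≋ₘ B → charPoly R m A ≈ₚ charPoly R m B
  charPoly-cong m {A} {B} A≋B = ≈ₚ-trans (charPoly≈det m A) (≈ₚ-trans
    (D.det-cong m (D.charMat-cong X (λ i j → κ-cong (A≋B i j)))) (≈ₚ-sym (charPoly≈det m B)))

  charPoly-similar : ∀ m {A B K : Mat R m} → D.Unit (D.det m (λ i j → κ (K i j))) → (K M.⊠ B) M.≋ₘ (A M.⊠ K) →
    charPoly R m B ≈ₚ charPoly R m A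
  charPoly-similar m {A} {B} {K} K-unit KB≋AK = ≈ₚ-trans (charPoly≈det m B) (≈ₚ-trans
    (D.charMat-similar m X K-unit (λ i j → ≈ₚ-trans (≈ₚ-sym (κ-⊠ K B i j)) (≈ₚ-trans (κ-cong (KB≋AK i j)) (κ-⊠ A K i j))))
    (≈ₚ-sym (charPoly≈det m A)))

  charPoly-block : ∀ m (A : Mat R (suc m)) → (∀ j → A zero j ≈ 0#) →
    charPoly R (suc m) A ≈ₚ X ⊗ charPoly R m (λ i j → A (suc i) (suc j))
  charPoly-block m A A₀≈0 = ≈ₚ-trans (charPoly≈det (suc m) A) (≈ₚ-trans
    (D.charMat-block m X (λ i j → κ (A i j)) (λ j → ≈ₚ-trans (κ-cong (A₀≈0 (suc j))) κ-0))
    (⊗-cong (≈ₚ-trans (⊕-cong {X} ≈ₚ-refl (pneg-cong (≈ₚ-trans (κ-cong (A₀≈0 zero)) κ-0))) (⊕-identityʳ X))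
      (≈ₚ-sym (charPoly≈det m _))))

  module _ {h : Carrier → Carrier} (h-hom : IsRingHomomorphism h) where
    open IsRingHomomorphism h-hom

    map-hom : RingMorphisms.IsRingHomomorphism P.rawRing P.rawRing (map h)
    map-hom = record
      { isSemiringHomomorphism = record
        { isNearSemiringHomomorphism = record
          { +-isMonoidHomomorphism = record
            { isMagmaHomomorphism = record
              { isRelHomomorphism = record { cong = map-cong }
              ; homo = map-⊕ }
            ; ε-homo = ≈ₚ-refl }
          ; *-homo = map-⊗ }
        ; 1#-homo = κ-cong 1#-homo }
      ; -‿homo = map-neg }
      where
      map-cong : ∀ {p q} → p ≈ₚ q → map h p ≈ₚ map h q
      map-cong {p} {q} p≈q .at i = trans (map-coeff 0#-homo p i) (trans (⟦⟧-cong (p≈q .at i)) (sym (map-coeff 0#-homo q i)))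

      map-⊕ : ∀ p q → map h (p ⊕ q) ≈ₚ map h p ⊕ map h q
      map-⊕ []      q       = ≈ₚ-refl
      map-⊕ (a ∷ p) []      = ≈ₚ-refl
      map-⊕ (a ∷ p) (b ∷ q) = ∷-congₚ (+-homo a b) (map-⊕ p q)

      map-scale : ∀ a p → map h (map (a *_) p) ≈ₚ map (h a *_) (map h p)
      map-scale a []      = ≈ₚ-refl
      map-scale a (b ∷ p) = ∷-congₚ (*-homo a b) (map-scale a p)

      map-neg : ∀ p → map h (pneg R p) ≈ₚ pneg R (map h p)
      map-neg []      = ≈ₚ-refl
      map-neg (a ∷ p) = ∷-congₚ (-‿homo a) (map-neg p)

      map-⊗ : ∀ p q → map h (p ⊗ q) ≈ₚ map h p ⊗ map h q
      map-⊗ []      q = ≈ₚ-refl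
      map-⊗ (a ∷ p) q = ≈ₚ-trans (map-⊕ (map (a *_) q) _)
        (⊕-cong (map-scale a q) (∷-congₚ 0#-homo (map-⊗ p q)))

    map-charPoly : ∀ m A → map h (charPoly R m A) ≈ₚ charPoly R m (mapMat R h A)
    map-charPoly m A = ≈ₚ-trans (hom.⟦⟧-cong (charPoly≈det m A)) (≈ₚ-trans (D.hom-det map-hom m (charMat A))
      (≈ₚ-trans (D.det-cong m entry) (≈ₚ-sym (charPoly≈det m _))))
      where
      module hom = RingMorphisms.IsRingHomomorphism map-hom
      entry : ∀ i j → map h (charMat A i j) ≈ₚ charMat (mapMat R h A) i j
      entry i j = ≈ₚ-trans (hom.+-homo (X ⊗ D.δ i j) (pneg R (κ (A i j))))
        (⊕-cong (≈ₚ-trans (hom.*-homo X (D.δ i j)) (⊗-cong (∷-congₚ 0#-homo (κ-cong 1#-homo)) (D.hom-δ map-hom i j))) (κ-cong (-‿homo (A i j))))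

  -- The first row of the companion matrix has -a₀/a_d in the last column and zeros elsewhere, and
  -- deleting that row and column leaves the identity.
  det-companion-unit : ∀ m a ainv → M.Unit (a zero) → M.Unit ainv →
    D.Unit (D.det (suc m) (λ i j → κ (companion R (suc m) a ainv i j)))
  det-companion-unit m a ainv a₀-unit ainv-unit = D.unit-resp (≈ₚ-sym det≈)
    (D.unit-* {D.sign (fromℕ m)} {κ (- (a zero * ainv))} (D.unit-sign (fromℕ m)) (κ-unit (M.unit-neg (M.unit-* a₀-unit ainv-unit))))
    where
    C : Mat R (suc m)
    C = companion R (suc m) a ainv

    corner : C zero (fromℕ m) ≡ - (a zero * ainv)
    corner rewrite dec-true (toℕ (fromℕ m) ℕ.≟ m) (Fin.toℕ-fromℕ m) = Eq.refl

    not-last : ∀ k → does (toℕ (punchIn (fromℕ m) k) ℕ.≟ m) ≡ false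
    not-last k = dec-false (_ ℕ.≟ m) (λ eq → ℕ.<⇒≢ (Fin.toℕ<n k) (Eq.trans (Eq.sym (toℕ-punchIn-fromℕ m k)) eq))

    row₀ : ∀ k → C zero (punchIn (fromℕ m) k) ≡ 0#
    row₀ k rewrite not-last k = Eq.refl

    minor : ∀ r s → κ (C (suc r) (punchIn (fromℕ m) s)) ≈ₚ D.δ r s
    minor r s rewrite not-last s | toℕ-punchIn-fromℕ m s | does-toℕ-≟ r s with does (r Fin.≟ s)
    ... | true  = ≈ₚ-refl
    ... | false = κ-0

    det≈ : D.det (suc m) (λ i j → κ (C i j)) ≈ₚ D.sign (fromℕ m) ⊗ κ (- (a zero * ainv))
    det≈ = ≈ₚ-trans (D.±-single _ (fromℕ m) (λ k → ⊗-cong {q = D.det m _} (≈ₚ-trans (κ-cong (reflexive (row₀ k))) κ-0) ≈ₚ-refl))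
      (⊗-congˡ (D.sign (fromℕ m)) (≈ₚ-trans
        (⊗-cong (κ-cong (reflexive corner)) (≈ₚ-trans (D.det-cong m minor) (D.det-δ m)))
        (P.*-identityʳ _)))

-- Twisted products of a matrix with its images under σ

module TwistedProducts {c ℓ} (R : CommutativeRing c ℓ) {σ : CommutativeRing.Carrier R → CommutativeRing.Carrier R}
  (σ-hom : RingMorphisms.IsRingHomomorphism (CommutativeRing.rawRing R) (CommutativeRing.rawRing R) σ) where
  open CommutativeRing R hiding (zero)
  open import Data.List.Base using (map)
  open RingMorphisms.IsRingHomomorphism σ-hom
  open import Relation.Binary.Reasoning.Setoid setoid
  open Determinant R
  open import Algebra.Properties.Ring ring using (-0#≈0#)
  open CharacteristicPolynomial R hiding (charMat)
  open Polynomials R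

  iter-cong : ∀ k {x y} → x ≈ y → iter R σ k x ≈ iter R σ k y
  iter-cong zero    x≈y = x≈y
  iter-cong (suc k) x≈y = ⟦⟧-cong (iter-cong k x≈y)

  iter-0 : ∀ k → iter R σ k 0# ≈ 0#
  iter-0 zero    = refl
  iter-0 (suc k) = trans (⟦⟧-cong (iter-0 k)) 0#-homo

  iter-fixed : ∀ {x} → σ x ≈ x → ∀ k → iter R σ k x ≈ x
  iter-fixed σx≈x zero    = refl
  iter-fixed σx≈x (suc k) = trans (⟦⟧-cong (iter-fixed σx≈x k)) σx≈x

  module _ {n : ℕ} (C : Mat R n) where
    T : ℕ → ℕ → Mat R n
    T = twistedProd R σ C

    C^ : ℕ → Mat R n
    C^ k = mapMat R (iter R σ k) C

    T-suc : ∀ r k → T (suc r) k ≋ₘ (C^ k ⊠ T r (suc k))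
    T-suc r k i j = reflexive (∑-unfold _)

    T-map : ∀ r k → mapMat R σ (T r k) ≋ₘ T r (suc k)
    T-map zero    k i j = hom-δ σ-hom i j
    T-map (suc r) k i j = begin
      σ (T (suc r) k i j)                              ≈⟨ ⟦⟧-cong (T-suc r k i j) ⟩
      σ (∑ (λ l → C^ k i l * T r (suc k) l j))         ≈⟨ hom-∑ σ-hom _ ⟩
      ∑ (λ l → σ (C^ k i l * T r (suc k) l j))         ≈⟨ ∑-cong (λ l → trans (*-homo _ _) (*-congˡ (T-map r (suc k) l j))) ⟩
      ∑ (λ l → C^ (suc k) i l * T r (suc (suc k)) l j) ≈⟨ T-suc r (suc k) i j ⟨
      T (suc r) (suc k) i j                            ∎

    -- `twistedProd` splits off its first factor. `T-conjugate` splits the same longer product at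
    -- both ends, so the last factor must be separable too.
    T-snoc : ∀ r k → T (suc r) k ≋ₘ (T r k ⊠ C^ (k ℕ.+ r))
    T-snoc zero k i j rewrite ℕ.+-identityʳ k = begin
      T 1 k i j          ≈⟨ T-suc 0 k i j ⟩
      (C^ k ⊠ δ) i j     ≈⟨ ∑-δʳ j (C^ k i) ⟩
      C^ k i j           ≈⟨ ∑-δˡ i (λ l → C^ k l j) ⟨
      (δ ⊠ C^ k) i j     ∎
    T-snoc (suc r) k i j rewrite ℕ.+-suc k r = begin
      T (suc (suc r)) k i j                               ≈⟨ T-suc (suc r) k i j ⟩
      (C^ k ⊠ T (suc r) (suc k)) i j                      ≈⟨ ⊠-cong {A = C^ k} (λ _ _ → refl) (T-snoc r (suc k)) i j ⟩
      (C^ k ⊠ (T r (suc k) ⊠ C^ (suc k ℕ.+ r))) i j       ≈⟨ ⊠-assoc (C^ k) (T r (suc k)) (C^ (suc k ℕ.+ r)) i j ⟨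
      (C^ k ⊠ T r (suc k) ⊠ C^ (suc k ℕ.+ r)) i j         ≈⟨ ⊠-cong {C = C^ (suc k ℕ.+ r)} (T-suc r k) (λ _ _ → refl) i j ⟨
      (T (suc r) k ⊠ C^ (suc k ℕ.+ r)) i j                ∎

    T-conjugate : ∀ r → (∀ x → iter R σ r x ≈ x) → (C ⊠ T r 1) ≋ₘ (T r 0 ⊠ C)
    T-conjugate r σʳ≈id i j = begin
      (C ⊠ T r 1) i j        ≈⟨ T-suc r 0 i j ⟨
      T (suc r) 0 i j        ≈⟨ T-snoc r 0 i j ⟩
      (T r 0 ⊠ C^ r) i j     ≈⟨ ⊠-cong {A = T r 0} (λ _ _ → refl) (λ k l → σʳ≈id (C k l)) i j ⟩
      (T r 0 ⊠ C) i j        ∎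

  module _ {n : ℕ} (C : Mat R (suc n)) (C₀≈0 : ∀ j → C zero j ≈ 0#) where
    C₀^ : ∀ k j → C^ C k zero j ≈ 0#
    C₀^ k j = trans (iter-cong k (C₀≈0 j)) (iter-0 k)

    T-row₀ : ∀ r k j → T C (suc r) k zero j ≈ 0#
    T-row₀ r k j = trans (T-suc C r k zero j) (∑-0 (λ l → trans (*-congʳ (C₀^ k l)) (zeroˡ _)))

    T-block : ∀ r k i j → T C r k (suc i) (suc j) ≈ T (λ i j → C (suc i) (suc j)) r k i j
    T-block zero    k i j = refl
    T-block (suc r) k i j = begin
      T C (suc r) k (suc i) (suc j)
        ≈⟨ trans (T-suc C r k (suc i) (suc j)) (reflexive (∑-suc _)) ⟩
      C^ C k (suc i) zero * T C r (suc k) zero (suc j) + ∑ (λ l → C^ C k (suc i) (suc l) * T C r (suc k) (suc l) (suc j))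
        ≈⟨ +-cong (trans (*-congˡ (T-row₀′ r (suc k) j)) (zeroʳ _)) (∑-cong (λ l → *-congˡ (T-block r (suc k) l j))) ⟩
      0# + (C^ C′ k ⊠ T C′ r (suc k)) i j
        ≈⟨ trans (+-identityˡ _) (sym (T-suc C′ r k i j)) ⟩
      T C′ (suc r) k i j ∎
      where
      C′ : Mat R n
      C′ i j = C (suc i) (suc j)
      -- The empty product is the identity, whose first row is not zero. Off the diagonal it is,
      -- which is all that the block computation requires.
      T-row₀′ : ∀ r k j → T C r k zero (suc j) ≈ 0#
      T-row₀′ zero    k j = refl
      T-row₀′ (suc r) k j = T-row₀ r k (suc j)

  -- If a₀ ≠ 0, then C_L conjugates σ(A_L) into A_L. If a₀ = 0, then the first row of A_L
  -- vanishes and the complementary block is A_{L′} with L′ = a₁x + … + a_d x^{σ^{d-1}}.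
  charPoly-twistedProd : (∀ x → x ≈ 0# ⊎ Unit x) → ∀ r → (∀ x → iter R σ (suc r) x ≈ x) →
    ∀ d a ainv → Unit ainv →
    charPoly R d (twistedProd R σ (companion R d a ainv) (suc r) 1) ≈ₚ charPoly R d (AL R d σ (suc r) a ainv)
  -- When the low coefficients vanish, the descent in `d` can reach the empty matrix, whose
  -- characteristic polynomial is 1.
  charPoly-twistedProd zero? r σʳ≈id zero    a ainv ainv-unit = ≈ₚ-refl
  charPoly-twistedProd zero? r σʳ≈id (suc d) a ainv ainv-unit with zero? (a zero)
  ... | inj₂ a₀-unit = charPoly-similar (suc d) (det-companion-unit d a ainv a₀-unit ainv-unit)
                         (T-conjugate (companion R (suc d) a ainv) (suc r) σʳ≈id)
  ... | inj₁ a₀≈0    = ≈ₚ-trans (reduce 1) (≈ₚ-trans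
                         -- L′ drops a₀ and keeps the leading coefficient of L, so the same `ainv`
                         -- serves.
                         (⊗-congˡ X (charPoly-twistedProd zero? r σʳ≈id d (a ∘ suc) ainv ainv-unit))
                         (≈ₚ-sym (reduce 0)))
    where
    C : Mat R (suc d)
    C = companion R (suc d) a ainv

    C₀≈0 : ∀ j → C zero j ≈ 0#
    C₀≈0 j with does (toℕ j ℕ.≟ d)
    ... | true  = trans (-‿cong (trans (*-congʳ a₀≈0) (zeroˡ ainv))) -0#≈0#
    ... | false = refl

    reduce : ∀ k → charPoly R (suc d) (T C (suc r) k) ≈ₚ X ⊗ charPoly R d (T (companion R d (a ∘ suc) ainv) (suc r) k)
    reduce k = ≈ₚ-trans (charPoly-block d (T C (suc r) k) (T-row₀ C C₀≈0 r k))
      (⊗-congˡ X (charPoly-cong d (T-block C C₀≈0 (suc r) k)))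

  charPoly-AL-fixed : (∀ x → x ≈ 0# ⊎ Unit x) → ∀ r → (∀ x → iter R σ (suc r) x ≈ x) →
    ∀ d a ainv → Unit ainv → ∀ i →
    σ (coeff R (charPoly R d (AL R d σ (suc r) a ainv)) i) ≈ coeff R (charPoly R d (AL R d σ (suc r) a ainv)) i
  charPoly-AL-fixed zero? r σʳ≈id d a ainv ainv-unit i = begin
    σ (coeff R (charPoly R d A) i)                 ≈⟨ map-coeff 0#-homo (charPoly R d A) i ⟨
    coeff R (map σ (charPoly R d A)) i             ≈⟨ map-charPoly σ-hom d A .at i ⟩
    coeff R (charPoly R d (mapMat R σ A)) i        ≈⟨ charPoly-cong d (T-map C (suc r) 0) .at i ⟩
    coeff R (charPoly R d (T C (suc r) 1)) i       ≈⟨ charPoly-twistedProd zero? r σʳ≈id d a ainv ainv-unit .at i ⟩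
    coeff R (charPoly R d A) i                     ∎
    where
    C : Mat R d
    C = companion R d a ainv
    A : Mat R d
    A = AL R d σ (suc r) a ainv

-- Binomial coefficients divisible by a prime

module BinomialCoefficients where
  open import Data.Nat.Combinatorics using (_C_; k>n⇒nCk≡0; nCk+nC[k+1]≡[n+1]C[k+1])
  open import Data.Nat.Divisibility using (_∣_; ∣⇒≤; m∣m*n)
  open import Data.Nat.Solver using (module +-*-Solver)

  [k+1]*[n+1]C[k+1]≡[n+1]*nCk : ∀ n k → suc k ℕ.* (suc n C suc k) ≡ suc n ℕ.* (n C k)
  [k+1]*[n+1]C[k+1]≡[n+1]*nCk zero    zero    = Eq.refl
  [k+1]*[n+1]C[k+1]≡[n+1]*nCk zero    (suc k) = begin
    suc (suc k) ℕ.* (1 C suc (suc k))   ≡⟨ Eq.cong (suc (suc k) ℕ.*_) (k>n⇒nCk≡0 {1} {suc (suc k)} (s≤s (s≤s z≤n))) ⟩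
    suc (suc k) ℕ.* 0                   ≡⟨ ℕ.*-zeroʳ (suc (suc k)) ⟩
    0                                   ≡⟨ Eq.cong (1 ℕ.*_) (k>n⇒nCk≡0 {0} {suc k} (s≤s z≤n)) ⟨
    1 ℕ.* (0 C suc k)                   ∎
    where open Eq.≡-Reasoning
  [k+1]*[n+1]C[k+1]≡[n+1]*nCk (suc n) zero    = begin
    1 ℕ.* (suc (suc n) C 1)                ≡⟨ Eq.cong (1 ℕ.*_) (nCk+nC[k+1]≡[n+1]C[k+1] (suc n) 0) ⟨
    1 ℕ.* (1 ℕ.+ (suc n C 1))              ≡⟨ ℕ.*-distribˡ-+ 1 1 (suc n C 1) ⟩
    1 ℕ.+ 1 ℕ.* (suc n C 1)                ≡⟨ Eq.cong (1 ℕ.+_) ([k+1]*[n+1]C[k+1]≡[n+1]*nCk n zero) ⟩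
    1 ℕ.+ suc n ℕ.* 1                      ∎
    where open Eq.≡-Reasoning
  [k+1]*[n+1]C[k+1]≡[n+1]*nCk (suc n) (suc k) = begin
    suc (suc k) ℕ.* (suc (suc n) C suc (suc k))
      ≡⟨ Eq.cong (suc (suc k) ℕ.*_) (nCk+nC[k+1]≡[n+1]C[k+1] (suc n) (suc k)) ⟨
    suc (suc k) ℕ.* ((suc n C suc k) ℕ.+ (suc n C suc (suc k)))
      ≡⟨ solve 3 (λ k a b → (con 1 :+ k) :* (a :+ b) := a :+ k :* a :+ (con 1 :+ k) :* b) Eq.refl (suc k) (suc n C suc k) _ ⟩
    (suc n C suc k) ℕ.+ suc k ℕ.* (suc n C suc k) ℕ.+ suc (suc k) ℕ.* (suc n C suc (suc k))
      ≡⟨ Eq.cong₂ (λ a b → (suc n C suc k) ℕ.+ a ℕ.+ b) ([k+1]*[n+1]C[k+1]≡[n+1]*nCk n k) ([k+1]*[n+1]C[k+1]≡[n+1]*nCk n (suc k)) ⟩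
    (suc n C suc k) ℕ.+ suc n ℕ.* (n C k) ℕ.+ suc n ℕ.* (n C suc k)
      ≡⟨ solve 4 (λ c n a b → c :+ n :* a :+ n :* b := c :+ n :* (a :+ b)) Eq.refl (suc n C suc k) (suc n) (n C k) (n C suc k) ⟩
    (suc n C suc k) ℕ.+ suc n ℕ.* ((n C k) ℕ.+ (n C suc k))
      ≡⟨ Eq.cong (λ a → (suc n C suc k) ℕ.+ suc n ℕ.* a) (nCk+nC[k+1]≡[n+1]C[k+1] n k) ⟩
    suc (suc n) ℕ.* (suc n C suc k) ∎
    where
    open Eq.≡-Reasoning
    open +-*-Solver using (solve; _:=_; _:+_; _:*_; con)

  -- By the absorption identity, `suc k` times the coefficient is a multiple of the prime `suc p`.
  -- As 0 < `suc k` < `suc p`, Euclid's lemma leaves only the coefficient.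
  prime∣pC[k+1] : ∀ {p} → Prime (suc p) → ∀ {k} → k < p → suc p ∣ (suc p C suc k)
  prime∣pC[k+1] {p} p-prime {k} k<p with
    euclidsLemma (suc k) (suc p C suc k) p-prime
      (Eq.subst (suc p ∣_) (Eq.sym ([k+1]*[n+1]C[k+1]≡[n+1]*nCk p k)) (m∣m*n (p C k)))
  ... | inj₁ p∣k+1 = contradiction (∣⇒≤ p∣k+1) (ℕ.<⇒≱ (s≤s k<p))
  ... | inj₂ p∣C   = p∣C

-- Powers and the Frobenius homomorphism

module Powers {c ℓ} (R : CommutativeRing c ℓ) where
  open CommutativeRing R hiding (zero)
  open BinomialCoefficients using (prime∣pC[k+1])
  open import Data.Nat.Combinatorics using (nCn≡1)
  open import Data.Nat.Divisibility using (_∣_; divides)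
  open import Algebra.Properties.Ring ring
  open import Algebra.Properties.Semiring.Mult semiring using ()
    renaming (_×_ to _·_; ×-congʳ to ·-congʳ; ×-assocˡ to ·-assocˡ; ×-assoc-* to ·-assoc-*)
  open import Algebra.Properties.Semiring.Exp semiring using (^-assocʳ) renaming (_^_ to _↑_)
  open import Algebra.Properties.CommutativeSemiring.Exp commutativeSemiring using (^-distrib-*)
  open import Algebra.Properties.CommutativeSemiring.Binomial commutativeSemiring using (binomialTerm)
    renaming (theorem to binomial-theorem)
  open import Algebra.Properties.Semiring.Sum semiring using (sum; sum-cong-≋; sum-replicate-zero; sum-init-last)
  open import Relation.Binary.Reasoning.Setoid setoid

  pow≡^ : ∀ x n → pow R x n ≡ x ↑ n
  pow≡^ x zero    = Eq.refl
  pow≡^ x (suc n) = Eq.cong (x *_) (pow≡^ x n)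

  pow-cong : ∀ n {x y} → x ≈ y → pow R x n ≈ pow R y n
  pow-cong zero    x≈y = refl
  pow-cong (suc n) x≈y = *-cong x≈y (pow-cong n x≈y)

  pow-* : ∀ n x y → pow R (x * y) n ≈ pow R x n * pow R y n
  pow-* n x y rewrite pow≡^ (x * y) n | pow≡^ x n | pow≡^ y n = ^-distrib-* x y n

  pow-1 : ∀ n → pow R 1# n ≈ 1#
  pow-1 zero    = refl
  pow-1 (suc n) = trans (*-identityˡ _) (pow-1 n)

  pow-pow : ∀ m n x → pow R (pow R x m) n ≈ pow R x (m ℕ.* n)
  pow-pow m n x rewrite pow≡^ x m | pow≡^ (x ↑ m) n | pow≡^ x (m ℕ.* n) = ^-assocʳ x m n

  iter-pow : ∀ q n x → iter R (λ y → pow R y q) n x ≈ pow R x (q ℕ.^ n)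
  iter-pow q zero    x = sym (*-identityʳ x)
  iter-pow q (suc n) x = begin
    pow R (iter R (λ y → pow R y q) n x) q   ≈⟨ pow-cong q (iter-pow q n x) ⟩
    pow R (pow R x (q ℕ.^ n)) q              ≈⟨ pow-pow (q ℕ.^ n) q x ⟩
    pow R x (q ℕ.^ n ℕ.* q)                  ≡⟨ Eq.cong (pow R x) (ℕ.*-comm (q ℕ.^ n) q) ⟩
    pow R x (q ℕ.^ suc n)                    ∎

  ∣⇒·≈0 : ∀ {p n} → p · 1# ≈ 0# → p ∣ n → ∀ x → n · x ≈ 0#
  ∣⇒·≈0 {p} p·1≈0 (divides k Eq.refl) x = begin
    (k ℕ.* p) · x         ≈⟨ ·-assocˡ x k p ⟨
    k · (p · x)           ≈⟨ ·-congʳ k (·-congʳ p (*-identityˡ x)) ⟨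
    k · (p · (1# * x))    ≈⟨ ·-congʳ k (·-assoc-* p 1# x) ⟨
    k · ((p · 1#) * x)    ≈⟨ ·-congʳ k (trans (*-congʳ p·1≈0) (zeroˡ x)) ⟩
    k · 0#                ≈⟨ ·-zero k ⟩
    0#                    ∎
    where
    ·-zero : ∀ k → k · 0# ≈ 0#
    ·-zero zero    = refl
    ·-zero (suc k) = trans (+-identityˡ _) (·-zero k)

  module _ {p} (p-prime : Prime p) (p·1≈0 : p · 1# ≈ 0#) where

    freshman : ∀ x y → (x + y) ↑ p ≈ x ↑ p + y ↑ p
    freshman = go p-prime p·1≈0
      where
      -- The prime is quantified anew so that it can be matched as a successor. The binomial sum
      -- then splits into its two end terms and the middle ones, which the characteristic kills.
      go : ∀ {p} → Prime p → p · 1# ≈ 0# → ∀ x y → (x + y) ↑ p ≈ x ↑ p + y ↑ p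
      go {zero}  p-prime p·1≈0 x y = contradiction p-prime ¬prime[0]
      go {suc p} p-prime p·1≈0 x y = begin
        (x + y) ↑ suc p                                      ≈⟨ binomial-theorem (suc p) x y ⟩
        t zero + sum (t ∘ suc)                               ≈⟨ +-congˡ (sum-init-last (t ∘ suc)) ⟩
        t zero + (sum (t ∘ suc ∘ inject₁) + t (suc (fromℕ p)))  ≈⟨ +-congˡ (+-congʳ (trans (sum-cong-≋ middle) (sum-replicate-zero p))) ⟩
        t zero + (0# + t (suc (fromℕ p)))                    ≈⟨ +-cong first (trans (+-identityˡ _) last) ⟩
        y ↑ suc p + x ↑ suc p                                ≈⟨ +-comm _ _ ⟩
        x ↑ suc p + y ↑ suc p                                ∎
        where
        t : Fin (suc (suc p)) → Carrier
        t = binomialTerm x y (suc p)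
        first : t zero ≈ y ↑ suc p
        first = trans (+-identityʳ _) (*-identityˡ _)
        last : t (suc (fromℕ p)) ≈ x ↑ suc p
        last rewrite Fin.toℕ-fromℕ p | nCn≡1 (suc p) | ℕ.n∸n≡0 p = trans (+-identityʳ _) (*-identityʳ _)
        middle : ∀ i → t (suc (inject₁ i)) ≈ 0#
        middle i rewrite Fin.toℕ-inject₁ i = ∣⇒·≈0 p·1≈0 (prime∣pC[k+1] p-prime (Fin.toℕ<n i)) _

    pow-+ : ∀ k x y → pow R (x + y) (p ℕ.^ k) ≈ pow R x (p ℕ.^ k) + pow R y (p ℕ.^ k)
    pow-+ zero    x y = trans (*-identityʳ _) (sym (+-cong (*-identityʳ x) (*-identityʳ y)))
    pow-+ (suc k) x y = begin
      pow R (x + y) (p ℕ.* p ℕ.^ k)                                  ≈⟨ pow-pow p (p ℕ.^ k) (x + y) ⟨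
      pow R (pow R (x + y) p) (p ℕ.^ k)                              ≈⟨ pow-cong (p ℕ.^ k) additive ⟩
      pow R (pow R x p + pow R y p) (p ℕ.^ k)                        ≈⟨ pow-+ k _ _ ⟩
      pow R (pow R x p) (p ℕ.^ k) + pow R (pow R y p) (p ℕ.^ k)      ≈⟨ +-cong (pow-pow p _ x) (pow-pow p _ y) ⟩
      pow R x (p ℕ.* p ℕ.^ k) + pow R y (p ℕ.* p ℕ.^ k)              ∎
      where
      additive : pow R (x + y) p ≈ pow R x p + pow R y p
      additive rewrite pow≡^ (x + y) p | pow≡^ x p | pow≡^ y p = freshman x y

    pow-hom : ∀ k → RingMorphisms.IsRingHomomorphism rawRing rawRing (λ x → pow R x (p ℕ.^ k))
    pow-hom k = record
      { isSemiringHomomorphism = record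
        { isNearSemiringHomomorphism = record
          { +-isMonoidHomomorphism = record
            { isMagmaHomomorphism = record
              { isRelHomomorphism = record { cong = pow-cong (p ℕ.^ k) }
              ; homo = pow-+ k }
            ; ε-homo = pow-0 }
          ; *-homo = pow-* (p ℕ.^ k) }
        ; 1#-homo = pow-1 (p ℕ.^ k) }
      -- Deduced from additivity, so the parity of the exponent never enters.
      ; -‿homo = λ x → +-inverseˡ-unique _ _ (trans (sym (pow-+ k (- x) x)) (trans (pow-cong (p ℕ.^ k) (-‿inverseˡ x)) pow-0)) }
      where
      pow-0 : pow R 0# (p ℕ.^ k) ≈ 0#
      pow-0 = x+x≈x⇒x≈0 _ (trans (sym (pow-+ k 0# 0#)) (pow-cong (p ℕ.^ k) (+-identityˡ 0#)))

-- Finite fields: decidability, characteristic and Fermat's identity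

module Field {c ℓ} (F : CommutativeRing c ℓ) where
  open CommutativeRing F hiding (zero)

  module Finite
    (1≉0 : ¬ (1# ≈ 0#)) (inverse : ∀ x → ¬ (x ≈ 0#) → ∃ λ y → x * y ≈ 1#)
    {N : ℕ} (enum : Bijection (Eq.setoid (Fin N)) setoid) where
    open import Algebra.Properties.Ring ring
    open import Algebra.Properties.Semiring.Mult semiring using () renaming (_×_ to _·_; ×1-homo-* to ·1-homo-*)
    open import Relation.Binary.Reasoning.Setoid setoid
    open Bijection enum using (to; injective; surjective)
    open Determinant F using (Unit; unit-*; unit-cancel)
    open Powers F

    index : Carrier → Fin N
    index x = proj₁ (surjective x)

    to-index : ∀ x → to (index x) ≈ x
    to-index x = proj₂ (surjective x) Eq.refl

    infix 4 _≈?_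
    _≈?_ : ∀ x y → Dec (x ≈ y)
    x ≈? y with index x Fin.≟ index y
    ... | yes eq = yes (trans (sym (to-index x)) (trans (reflexive (Eq.cong to eq)) (to-index y)))
    ... | no neq = no (λ x≈y → neq (injective (trans (to-index x) (trans x≈y (sym (to-index y))))))

    zero⊎unit : ∀ x → x ≈ 0# ⊎ Unit x
    zero⊎unit x with x ≈? 0#
    ... | yes x≈0 = inj₁ x≈0
    ... | no  x≉0 = inj₂ (inverse x x≉0)

    unit-nonzero : ∀ {x} → Unit x → ¬ (x ≈ 0#)
    unit-nonzero (y , xy≈1) x≈0 = 1≉0 (trans (sym xy≈1) (trans (*-congʳ x≈0) (zeroˡ y)))

    integral : ∀ x y → x * y ≈ 0# → x ≈ 0# ⊎ y ≈ 0#
    integral x y xy≈0 with zero⊎unit x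
    ... | inj₁ x≈0 = inj₁ x≈0
    ... | inj₂ x-unit@(x′ , xx′≈1) = inj₂ (begin
      y               ≈⟨ trans (*-congʳ xx′≈1) (*-identityˡ y) ⟨
      x * x′ * y      ≈⟨ trans (*-congʳ (*-comm x x′)) (*-assoc x′ x y) ⟩
      x′ * (x * y)    ≈⟨ trans (*-congˡ xy≈0) (zeroʳ x′) ⟩
      0#              ∎)

    -- Transports a bijection of the field, valid up to `≈`, to the index set, so that sums and
    -- products over the enumeration can be reordered.
    relabel : (τ τ′ : Carrier → Carrier) → (∀ {x y} → x ≈ y → τ x ≈ τ y) → (∀ {x y} → x ≈ y → τ′ x ≈ τ′ y) →
      (∀ x → τ (τ′ x) ≈ x) → (∀ x → τ′ (τ x) ≈ x) → Permutation N N
    relabel τ τ′ τ-cong τ′-cong ττ′ τ′τ = permutation (index ∘ τ ∘ to) (index ∘ τ′ ∘ to)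
      (λ i → injective (trans (to-index _) (trans (τ-cong (to-index _)) (ττ′ _))))
      (λ i → injective (trans (to-index _) (trans (τ′-cong (to-index _)) (τ′τ _))))

    -- Translation by 1 permutes the field. The sum of all elements is therefore unchanged, although
    -- each of the N terms has grown by 1.
    N·1≈0 : N · 1# ≈ 0#
    N·1≈0 = +-identityˡ-unique _ (sum to) (begin
      N · 1# + sum to                ≈⟨ +-congʳ (sum-replicate N) ⟨
      sum (λ (_ : Fin N) → 1#) + sum to  ≈⟨ ∑-distrib-+ (λ _ → 1#) to ⟨
      sum (λ i → 1# + to i)          ≈⟨ sum-cong-≋ {N} (λ i → to-index (1# + to i)) ⟨
      sum (to ∘ (π ⟨$⟩ʳ_))           ≈⟨ sum-permute to π ⟨
      sum to                         ∎)
      where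
      open import Algebra.Properties.CommutativeMonoid.Sum +-commutativeMonoid
      π : Permutation N N
      π = relabel (1# +_) (- 1# +_) +-congˡ +-congˡ
        (λ x → trans (sym (+-assoc _ _ _)) (trans (+-congʳ (-‿inverseʳ 1#)) (+-identityˡ x)))
        (λ x → trans (sym (+-assoc _ _ _)) (trans (+-congʳ (-‿inverseˡ 1#)) (+-identityˡ x)))

    module ∏ = CommutativeMonoidSum *-commutativeMonoid

    -- The single factor 1 sits at the index of the zero element. The extra `x` in front makes up
    -- for it, which gives exponent n and avoids n - 1.
    ∏-almost-constant : ∀ {n} (h : Fin n → Carrier) i x → h i ≈ 1# → (∀ j → j ≢ i → h j ≈ x) →
      x * ∏.sum h ≈ pow F x n
    ∏-almost-constant h zero x hi≈1 hj≈x =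
      *-congˡ (trans (*-congʳ hi≈1) (trans (*-identityˡ _) (constant _ (λ j → hj≈x (suc j) (λ ())))))
      where
      constant : ∀ {n} (h : Fin n → Carrier) → (∀ j → h j ≈ x) → ∏.sum h ≈ pow F x n
      constant {zero}  h h≈x = refl
      constant {suc n} h h≈x = *-cong (h≈x zero) (constant (h ∘ suc) (h≈x ∘ suc))
    ∏-almost-constant h (suc i) x hi≈1 hj≈x =
      *-congˡ (trans (*-congʳ (hj≈x zero (λ ()))) (∏-almost-constant (h ∘ suc) i x hi≈1 (λ j j≢i → hj≈x (suc j) (j≢i ∘ Fin.suc-injective))))

    pow-0 : ∀ {n} → Fin n → pow F 0# n ≈ 0#
    pow-0 {suc n} _ = zeroˡ _

    -- A product over the nonzero elements is taken over all indices, with 1 in the place belonging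
    -- to zero.
    nonzeroOr1 : Carrier → Carrier → Carrier
    nonzeroOr1 u y with y ≈? 0#
    ... | yes _ = 1#
    ... | no  _ = u

    -- Multiplication by a unit x permutes the nonzero elements, so x^{N-1} = 1 by comparing products.
    fermat : ∀ x → pow F x N ≈ x
    fermat x with zero⊎unit x
    ... | inj₁ x≈0 = trans (pow-cong N x≈0) (trans (pow-0 (index 0#)) (sym x≈0))
    ... | inj₂ x-unit@(x′ , xx′≈1) = begin
      pow F x N        ≈⟨ ∏-almost-constant h (index 0#) x h-index0 h-other ⟨
      x * ∏.sum h      ≈⟨ *-congˡ ∏h≈1 ⟩
      x * 1#           ≈⟨ *-identityʳ x ⟩
      x                ∎
      where
      g : Carrier → Carrier
      g y = nonzeroOr1 y y

      -- The ratio of the factors after and before multiplication by `x`: it is `x` at nonzero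
      -- elements and 1 at zero. Reordering shows that the product of these ratios is 1.
      h : Fin N → Carrier
      h i = nonzeroOr1 x (to i)

      h-index0 : h (index 0#) ≈ 1#
      h-index0 with to (index 0#) ≈? 0#
      ... | yes _  = refl
      ... | no neq = contradiction (to-index 0#) neq

      h-other : ∀ j → j ≢ index 0# → h j ≈ x
      h-other j j≢ with to j ≈? 0#
      ... | yes eq = contradiction (injective (trans eq (sym (to-index 0#)))) j≢
      ... | no _   = refl

      g-cong : ∀ {y z} → y ≈ z → g y ≈ g z
      g-cong {y} {z} y≈z with y ≈? 0# | z ≈? 0#
      ... | yes _   | yes _   = refl
      ... | yes y≈0 | no z≉0  = contradiction (trans (sym y≈z) y≈0) z≉0
      ... | no y≉0  | yes z≈0 = contradiction (trans y≈z z≈0) y≉0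
      ... | no _    | no _    = y≈z

      g-unit : ∀ y → Unit (g y)
      g-unit y with y ≈? 0#
      ... | yes _  = 1# , *-identityˡ 1#
      ... | no y≉0 = inverse y y≉0

      g-scale : ∀ y → g (x * y) ≈ nonzeroOr1 x y * g y
      g-scale y with x * y ≈? 0# | y ≈? 0#
      ... | yes _    | yes _   = sym (*-identityˡ 1#)
      ... | no _     | no _    = refl
      ... | no xy≉0  | yes y≈0 = contradiction (trans (*-congˡ y≈0) (zeroʳ x)) xy≉0
      ... | yes xy≈0 | no y≉0  with integral x y xy≈0
      ...   | inj₁ x≈0 = contradiction x≈0 (unit-nonzero x-unit)
      ...   | inj₂ y≈0 = contradiction y≈0 y≉0

      ∏-unit : ∀ {n} (u : Fin n → Carrier) → (∀ i → Unit (u i)) → Unit (∏.sum u)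
      ∏-unit {zero}  u u-unit = 1# , *-identityˡ 1#
      ∏-unit {suc n} u u-unit = unit-* (u-unit zero) (∏-unit (u ∘ suc) (u-unit ∘ suc))

      π : Permutation N N
      π = relabel (x *_) (x′ *_) *-congˡ *-congˡ
        (λ y → trans (sym (*-assoc _ _ _)) (trans (*-congʳ xx′≈1) (*-identityˡ y)))
        (λ y → trans (sym (*-assoc _ _ _)) (trans (*-congʳ (trans (*-comm x′ x) xx′≈1)) (*-identityˡ y)))

      ∏h≈1 : ∏.sum h ≈ 1#
      ∏h≈1 = sym (unit-cancel (∏-unit (g ∘ to) (g-unit ∘ to)) (begin
        ∏.sum (g ∘ to) * 1#                ≈⟨ *-identityʳ _ ⟩
        ∏.sum (g ∘ to)                     ≈⟨ ∏.sum-permute (g ∘ to) π ⟩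
        ∏.sum (g ∘ to ∘ (π ⟨$⟩ʳ_))         ≈⟨ ∏.sum-cong-≋ (λ i → trans (g-cong (to-index _)) (g-scale (to i))) ⟩
        ∏.sum (λ i → h i * g (to i))       ≈⟨ ∏.∑-distrib-+ h (g ∘ to) ⟩
        ∏.sum h * ∏.sum (g ∘ to)           ∎))

    -- p^m · 1 is the m-th power of p · 1 and equals N · 1 = 0. Without zero divisors, p · 1 itself
    -- must vanish.
    characteristic : ∀ {p} m → N ≡ p ℕ.^ m → p · 1# ≈ 0#
    characteristic {p} m N≡pᵐ = go m (trans (reflexive (Eq.cong (_· 1#) (Eq.sym N≡pᵐ))) N·1≈0)
      where
      go : ∀ m → (p ℕ.^ m) · 1# ≈ 0# → p · 1# ≈ 0#
      go zero    eq = contradiction (trans (sym (+-identityʳ 1#)) eq) 1≉0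
      go (suc m) eq with integral (p · 1#) ((p ℕ.^ m) · 1#) (trans (sym (·1-homo-* p (p ℕ.^ m))) eq)
      ... | inj₁ p·1≈0 = p·1≈0
      ... | inj₂ pᵐ≈0  = go m pᵐ≈0

-- Evaluation of polynomials and roots

module Evaluation {c ℓ} (R : CommutativeRing c ℓ) where
  open import Data.List.Base using ([]; _∷_; map)
  open CommutativeRing R hiding (zero)
  open import Algebra.Properties.Ring ring
  open import Relation.Binary.Reasoning.Setoid setoid
  open IntegerSolver R using (solve; _:=_; _:+_; _:*_; :-_; con)
  open Polynomials R

  eval : Poly R → Carrier → Carrier
  eval []      y = 0#
  eval (a ∷ p) y = a + y * eval p y

  eval-0 : ∀ {p} y → p ≈ₚ [] → eval p y ≈ 0#
  eval-0 {[]}    y p≈0 = refl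
  eval-0 {a ∷ p} y p≈0 = trans (+-cong (p≈0 .at 0) (trans (*-congˡ (eval-0 {p} y (coeffs (λ i → p≈0 .at (suc i))))) (zeroʳ y))) (+-identityˡ 0#)

  eval-cong : ∀ {p q} y → p ≈ₚ q → eval p y ≈ eval q y
  eval-cong {[]}            y p≈q = sym (eval-0 y (≈ₚ-sym p≈q))
  eval-cong {a ∷ p} {[]}    y p≈q = eval-0 y p≈q
  eval-cong {a ∷ p} {b ∷ q} y p≈q = +-cong (p≈q .at 0) (*-congˡ (eval-cong {p} {q} y (coeffs (λ i → p≈q .at (suc i)))))

  eval-⊕ : ∀ p q y → eval (p ⊕ q) y ≈ eval p y + eval q y
  eval-⊕ []      q       y = sym (+-identityˡ _)
  eval-⊕ (a ∷ p) []      y = sym (+-identityʳ _)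
  eval-⊕ (a ∷ p) (b ∷ q) y = trans (+-congˡ (*-congˡ (eval-⊕ p q y)))
    (solve 5 (λ a b y p q → a :+ b :+ y :* (p :+ q) := a :+ y :* p :+ (b :+ y :* q)) refl a b y (eval p y) (eval q y))

  eval-scale : ∀ a p y → eval (map (a *_) p) y ≈ a * eval p y
  eval-scale a []      y = sym (zeroʳ a)
  eval-scale a (b ∷ p) y = trans (+-congˡ (*-congˡ (eval-scale a p y)))
    (solve 4 (λ a b y p → a :* b :+ y :* (a :* p) := a :* (b :+ y :* p)) refl a b y (eval p y))

  eval-⊗ : ∀ p q y → eval (p ⊗ q) y ≈ eval p y * eval q y
  eval-⊗ []      q y = sym (zeroˡ _)
  eval-⊗ (a ∷ p) q y = begin
    eval (map (a *_) q ⊕ shift (p ⊗ q)) y               ≈⟨ eval-⊕ (map (a *_) q) _ y ⟩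
    eval (map (a *_) q) y + (0# + y * eval (p ⊗ q) y)   ≈⟨ +-cong (eval-scale a q y) (trans (+-identityˡ _) (*-congˡ (eval-⊗ p q y))) ⟩
    a * eval q y + y * (eval p y * eval q y)            ≈⟨ solve 4 (λ a y p q → a :* q :+ y :* (p :* q) := (a :+ y :* p) :* q) refl a y (eval p y) (eval q y) ⟩
    (a + y * eval p y) * eval q y                       ∎

  X-_ : Carrier → Poly R
  X- a = - a ∷ 1# ∷ []

  X-‿cong : ∀ {a b} → a ≈ b → X- a ≈ₚ X- b
  X-‿cong a≈b = ∷-congₚ (-‿cong a≈b) ≈ₚ-refl

  eval-X- : ∀ a y → eval (X- a) y ≈ y - a
  eval-X- a y = trans (+-congˡ (trans (*-congˡ (trans (+-congˡ (zeroʳ y)) (+-identityʳ 1#))) (*-identityʳ y))) (+-comm _ y)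

  module _ {h} (h-hom : RingMorphisms.IsRingHomomorphism rawRing rawRing h) where
    open RingMorphisms.IsRingHomomorphism h-hom

    eval-map : ∀ p y → eval (map h p) (h y) ≈ h (eval p y)
    eval-map []      y = sym 0#-homo
    eval-map (a ∷ p) y = trans (+-congˡ (trans (*-congˡ (eval-map p y)) (sym (*-homo _ _)))) (sym (+-homo _ _))

    -- Applying `h` to the value of `p` at `x` moves it onto the coefficients and the argument, and
    -- the coefficients stay as they are.
    fixed-root : ∀ p → (∀ i → h (coeff R p i) ≈ coeff R p i) → ∀ x → eval p x ≈ 0# → eval p (h x) ≈ 0#
    fixed-root p p-fixed x p[x]≈0 = begin
      eval p (h x)            ≈⟨ eval-cong {map h p} {p} (h x) (coeffs (λ i → trans (map-coeff 0#-homo p i) (p-fixed i))) ⟨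
      eval (map h p) (h x)    ≈⟨ eval-map p x ⟩
      h (eval p x)            ≈⟨ ⟦⟧-cong p[x]≈0 ⟩
      h 0#                    ≈⟨ 0#-homo ⟩
      0#                      ∎

-- Conjugates under φ and the order of σ

module Conjugation {c ℓ} (R : CommutativeRing c ℓ) where
  open CommutativeRing R hiding (zero)

  module Conjugates
    (1≉0 : ¬ (1# ≈ 0#)) (integral : ∀ x y → x * y ≈ 0# → x ≈ 0# ⊎ y ≈ 0#)
    {φ : Carrier → Carrier} (φ-hom : RingMorphisms.IsRingHomomorphism rawRing rawRing φ)
    (n : ℕ) (φⁿ≈id : ∀ x → iter R φ (suc n) x ≈ x) where
    open import Data.List.Base using (map)
    open import Algebra.Properties.Ring ring
    open import Relation.Binary.Reasoning.Setoid setoid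
    open Polynomials R
    open CharacteristicPolynomial R using (map-hom)
    open Evaluation R
    open RingMorphisms.IsRingHomomorphism φ-hom using () renaming (⟦⟧-cong to φ-cong; -‿homo to φ-neg; 1#-homo to φ-1)

    iter-suc′ : ∀ m x → iter R φ m (φ x) ≡ iter R φ (suc m) x
    iter-suc′ zero    x = Eq.refl
    iter-suc′ (suc m) x = Eq.cong φ (iter-suc′ m x)

    iter-+ : ∀ k m x → iter R φ k (iter R φ m x) ≡ iter R φ (k ℕ.+ m) x
    iter-+ zero    m x = Eq.refl
    iter-+ (suc k) m x = Eq.cong φ (iter-+ k m x)

    φ-iter-cong : ∀ k {x y} → x ≈ y → iter R φ k x ≈ iter R φ k y
    φ-iter-cong zero    x≈y = x≈y
    φ-iter-cong (suc k) x≈y = φ-cong (φ-iter-cong k x≈y)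

    iter-period : ∀ k x → iter R φ (k ℕ.* suc n) x ≈ x
    iter-period zero    x = refl
    iter-period (suc k) x = begin
      iter R φ (suc n ℕ.+ k ℕ.* suc n) x            ≡⟨ iter-+ (suc n) (k ℕ.* suc n) x ⟨
      iter R φ (suc n) (iter R φ (k ℕ.* suc n) x)   ≈⟨ φⁿ≈id _ ⟩
      iter R φ (k ℕ.* suc n) x                      ≈⟨ iter-period k x ⟩
      x                                             ∎

    -- The product of X - φʲ x for j < m. Recursing on `φ x` makes the action of φ on the
    -- coefficients a mere replacement of x by φ x.
    conjugates : ℕ → Carrier → Poly R
    conjugates zero    x = pconst R 1#
    conjugates (suc m) x = (X- x) ⊗ conjugates m (φ x)

    conjugates-snoc : ∀ m x → conjugates (suc m) x ≈ₚ conjugates m x ⊗ (X- iter R φ m x)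
    conjugates-snoc zero    x = ⊗-comm (X- x) (pconst R 1#)
    conjugates-snoc (suc m) x = ≈ₚ-trans (⊗-congˡ (X- x) (≈ₚ-trans (conjugates-snoc m (φ x))
        (⊗-congˡ (conjugates m (φ x)) (X-‿cong (reflexive (iter-suc′ m x))))))
      (≈ₚ-sym (⊗-assoc (X- x) (conjugates m (φ x)) _))

    map-conjugates : ∀ m x → map φ (conjugates m x) ≈ₚ conjugates m (φ x)
    map-conjugates zero    x = ∷-congₚ φ-1 ≈ₚ-refl
    map-conjugates (suc m) x = ≈ₚ-trans
      (RingMorphisms.IsRingHomomorphism.*-homo (map-hom φ-hom) (X- x) (conjugates m (φ x)))
      (⊗-cong {p′ = X- φ x} (∷-congₚ (φ-neg x) (∷-congₚ φ-1 ≈ₚ-refl)) (map-conjugates m (φ x)))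

    -- φ shifts the roots to φ x, ..., φⁿ⁺¹ x. The last of them is x again, so moving its factor to
    -- the front restores the product.
    conjugates-invariant : ∀ x → map φ (conjugates (suc n) x) ≈ₚ conjugates (suc n) x
    conjugates-invariant x = ≈ₚ-trans (map-conjugates (suc n) x) (≈ₚ-trans (conjugates-snoc n (φ x))
      (≈ₚ-trans (⊗-congˡ (conjugates n (φ x)) (X-‿cong (trans (reflexive (iter-suc′ n x)) (φⁿ≈id x))))
        (⊗-comm (conjugates n (φ x)) (X- x))))

    conjugates-root : ∀ m x y → eval (conjugates m x) y ≈ 0# → ∃ λ j → y ≈ iter R φ j x
    conjugates-root zero    x y eq = contradiction (trans (sym (trans (+-congˡ (zeroʳ y)) (+-identityʳ 1#))) eq) 1≉0
    conjugates-root (suc m) x y eq =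
      [ (λ y-x≈0 → 0 , x-y≈0⇒x≈y y x (trans (sym (eval-X- x y)) y-x≈0))
      , (λ rest → let j , y≈ = conjugates-root m (φ x) y rest in suc j , trans y≈ (reflexive (iter-suc′ j x)))
      ]′ (integral _ _ (trans (sym (eval-⊗ (X- x) (conjugates m (φ x)) y)) eq))
      where open import Algebra.Properties.Group +-group using () renaming (x∙y⁻¹≈ε⇒x≈y to x-y≈0⇒x≈y)

    -- The polynomial with roots x, φ x, …, φⁿ x is fixed by φ, hence by σ, so σ permutes its roots.
    module _ {σ : Carrier → Carrier} (σ-hom : RingMorphisms.IsRingHomomorphism rawRing rawRing σ)
      (σ-fixes : ∀ x → φ x ≈ x → σ x ≈ x) (σφ≈φσ : ∀ x → σ (φ x) ≈ φ (σ x)) where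
      open RingMorphisms.IsRingHomomorphism σ-hom renaming (⟦⟧-cong to σ-cong)

      σ-conjugate : ∀ x → ∃ λ j → σ x ≈ iter R φ j x
      σ-conjugate x = conjugates-root (suc n) x (σ x)
        (fixed-root σ-hom (conjugates (suc n) x) (λ i → σ-fixes _ (φ-fixed i)) x
          (trans (eval-⊗ (X- x) (conjugates n (φ x)) x)
            (trans (*-congʳ (trans (eval-X- x x) (-‿inverseʳ x))) (zeroˡ _))))
        where
        φ-fixed : ∀ i → φ (coeff R (conjugates (suc n) x) i) ≈ coeff R (conjugates (suc n) x) i
        φ-fixed i = trans (sym (map-coeff (RingMorphisms.IsRingHomomorphism.0#-homo φ-hom) (conjugates (suc n) x) i))
          (conjugates-invariant x .at i)

      σ-iter : ∀ k x → σ (iter R φ k x) ≈ iter R φ k (σ x)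
      σ-iter zero    x = refl
      σ-iter (suc k) x = trans (σφ≈φσ _) (φ-cong (σ-iter k x))

      -- The exponent `j` is tied to this one `x`. Since σ commutes with the powers of φ, the same
      -- `j` also describes σ at every later point of the orbit.
      iter-σ : ∀ {j x} → σ x ≈ iter R φ j x → ∀ m → iter R σ m x ≈ iter R φ (m ℕ.* j) x
      iter-σ         σx≈ zero    = refl
      iter-σ {j} {x} σx≈ (suc m) = begin
        σ (iter R σ m x)                          ≈⟨ σ-cong (iter-σ {j} σx≈ m) ⟩
        σ (iter R φ (m ℕ.* j) x)                  ≈⟨ σ-iter (m ℕ.* j) x ⟩
        iter R φ (m ℕ.* j) (σ x)                  ≈⟨ φ-iter-cong (m ℕ.* j) σx≈ ⟩
        iter R φ (m ℕ.* j) (iter R φ j x)         ≡⟨ iter-+ (m ℕ.* j) j x ⟩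
        iter R φ (m ℕ.* j ℕ.+ j) x                ≡⟨ Eq.cong (λ k → iter R φ k x) (ℕ.+-comm (m ℕ.* j) j) ⟩
        iter R φ (suc m ℕ.* j) x                  ∎

      σⁿ≈id : ∀ x → iter R σ (suc n) x ≈ x
      σⁿ≈id x = let j , σx≈ = σ-conjugate x in begin
        iter R σ (suc n) x            ≈⟨ iter-σ {j} σx≈ (suc n) ⟩
        iter R φ (suc n ℕ.* j) x      ≡⟨ Eq.cong (λ k → iter R φ k x) (ℕ.*-comm (suc n) j) ⟩
        iter R φ (j ℕ.* suc n) x      ≈⟨ iter-period j x ⟩
        x                             ∎

theorem4 : ∀ {c ℓ} (F : CommutativeRing c ℓ) →
    let open CommutativeRing F in
    (q p k n : ℕ) → Prime p → 1 ≤ k → q ≡ p ^ k → 1 ≤ n →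
    ¬ (1# ≈ 0#) → (∀ x → ¬ (x ≈ 0#) → ∃ λ y → x * y ≈ 1#) →
    Bijection (Eq.setoid (Fin (q ^ n))) setoid →
    (σ : Carrier → Carrier) → RingMorphisms.IsRingIsomorphism rawRing rawRing σ →
    (∀ x → pow F x q ≈ x → σ x ≈ x) →
    (∀ (τ : Carrier → Carrier) → RingMorphisms.IsRingIsomorphism rawRing rawRing τ →
    (∀ x → pow F x q ≈ x → τ x ≈ x) →
    ∃ λ i → ∀ x → τ x ≈ iter F σ i x) →
    (d : ℕ) → 1 ≤ d → (a : Fin (suc d) → Carrier) → ¬ (a (fromℕ d) ≈ 0#) →
    (ainv : Carrier) → a (fromℕ d) * ainv ≈ 1# →
    ∀ i → pow F (coeff F (charPoly F d (AL F d σ n a ainv)) i) q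
    ≈ coeff F (charPoly F d (AL F d σ n a ainv)) i
theorem4 F q p k (suc n) p-prime 1≤k Eq.refl 1≤n 1≉0 inverse enum σ σ-iso σ-fixes σ-generates d 1≤d a ad≉0 ainv ad*ainv≈1 i =
  -- `a (fromℕ d)` is the witness that `ainv` is a unit. A coefficient fixed by σ is fixed by its
  -- `j`-th iterate, and that iterate raises to the power q.
  trans (φ≈σʲ _) (iter-fixed (charPoly-AL-fixed zero⊎unit n σⁿ d a ainv (a (fromℕ d) , trans (*-comm _ _) ad*ainv≈1) i) j)
  where
  open CommutativeRing F hiding (zero)
  open Field.Finite F 1≉0 inverse enum
  open Powers F
  open RingMorphisms.IsRingIsomorphism σ-iso using () renaming (isRingHomomorphism to σ-hom)
  open RingMorphisms.IsRingHomomorphism σ-hom using (*-homo; 1#-homo)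
  open TwistedProducts F σ-hom

  φ : Carrier → Carrier
  φ x = pow F x (p ^ k)

  φ-hom : RingMorphisms.IsRingHomomorphism rawRing rawRing φ
  -- The field has (p^k)^(n+1) = p^(k(n+1)) elements, a power of p, which determines the
  -- characteristic.
  φ-hom = pow-hom p-prime (characteristic {p} (k ℕ.* suc n) (ℕ.^-*-assoc p k (suc n))) k

  φⁿ≈id : ∀ x → iter F φ (suc n) x ≈ x
  φⁿ≈id x = trans (iter-pow (p ^ k) (suc n) x) (fermat x)

  open Conjugation.Conjugates F 1≉0 integral φ-hom n φⁿ≈id

  -- The generating property of σ concerns automorphisms, so φ must be bijective. With the degree
  -- matched as `suc n`, the inverse of φ is its n-th iterate.
  φ-iso : RingMorphisms.IsRingIsomorphism rawRing rawRing φ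
  φ-iso = record
    { isRingMonomorphism = record
      { isRingHomomorphism = φ-hom
      ; injective = λ {x} {y} φx≈φy → trans (sym (period x)) (trans (φ-iter-cong n φx≈φy) (period y)) }
    ; surjective = λ y → iter F φ n y , λ z≈ → trans (pow-cong (p ^ k) z≈) (φⁿ≈id y) }
    where
    period : ∀ x → iter F φ n (φ x) ≈ x
    period x = trans (reflexive (iter-suc′ n x)) (φⁿ≈id x)

  frobenius-power : ∃ λ j → ∀ x → φ x ≈ iter F σ j x
  frobenius-power = σ-generates φ φ-iso (λ x φx≈x → φx≈x)

  j : ℕ
  j = proj₁ frobenius-power

  φ≈σʲ : ∀ x → φ x ≈ iter F σ j x
  φ≈σʲ = proj₂ frobenius-power

  σ-pow : ∀ m x → σ (pow F x m) ≈ pow F (σ x) m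
  σ-pow zero    x = 1#-homo
  σ-pow (suc m) x = trans (*-homo x _) (*-congˡ (σ-pow m x))

  σⁿ : ∀ x → iter F σ (suc n) x ≈ x
  σⁿ = σⁿ≈id σ-hom σ-fixes (σ-pow (p ^ k))
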